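{- Let $K$ be a real quadratic number field with ring of integers $\mathcal{O}_K$, and let $P=[a_0,\dots,a_N,\overline{a_{N+1},\dots,a_{N+k}}]$ be an ultimately periodic continued fraction with all partial quotients $a_i\in\mathcal{O}_K$. Let $f(P)=E_{21}x^2+(E_{22}-E_{11})x-E_{12}$ be the quadratic polynomial associated to $P$, and let $\Delta=(E_{22}-E_{11})^2+4E_{12}E_{21}$ be its discriminant. If $\Delta$ is positive and is not a square in $K$, then the continued fraction $P$ converges. If $\Delta$ is negative, then the continued fraction $P$ does not converge.
   Context: For $\alpha\in\mathbb{C}$ let $D(\alpha)=\begin{bmatrix} \alpha & 1 \\ 1 & 0 \end{bmatrix}$. For an ultimately periodic continued fraction $P=[a_0,\dots,a_N,\overline{a_{N+1},\dots,a_{N+k}}]$ define $$E(P)=\begin{bmatrix} E_{11} & E_{12} \\ E_{21} & E_{22} \end{bmatrix}=\big(D(a_0)\cdots D(a_N)\big)\big(D(a_{N+1})\cdots D(a_{N+k})\big)\big(D(a_0)\cdots D(a_N)\big)^{ -1}.$$ The notation means that the infinite sequence of partial quotients consists of $a_0,\dots,a_N$ followed by the block $a_{N+1},\dots,a_{N+k}$ repeated forever; partial quotients $a_i$ with $i\ge1$ are nonzero, but may be negative. With $P_{ -1}=1,\ P_0=a_0,\ P_{n+1}=a_{n+1}P_n+P_{n-1}$ and $Q_{ -1}=0,\ Q_0=1,\ Q_{n+1}=a_{n+1}Q_n+Q_{n-1}$, the continued fraction converges if the sequence $P_n/Q_n$, viewed in $\mathbb{P}^1(\mathbb{C})$, has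 a limit. -}

module Defs where

open import Level using (Level; _⊔_; 0ℓ) renaming (suc to lsuc)
open import Algebra.Bundles using (CommutativeMonoid; CommutativeRing; RawRing)
open import Algebra.Morphism.Structures using (IsRingHomomorphism)
open import Data.Integer.Base using (ℤ)
open import Data.List.Base using (List; []; _∷_; foldr; applyUpTo)
open import Data.Nat.Base as ℕ using (ℕ; zero; suc)
import Data.Nat.Properties as ℕ
open import Data.Product.Base using (∃; ∃-syntax; _×_; _,_)
open import Data.Rational.Base as ℚ using (ℚ; 0ℚ; 1ℚ; ½; ∣_∣)
import Data.Rational.Properties as ℚ
open import Relation.Binary.PropositionalEquality
  using (_≡_; sym; trans; cong; cong₂; subst)
open import Relation.Nullary using (¬_)
open import Relation.Nullary.Decidable using (dec⇒maybe)
open import Tactic.RingSolver using (solve)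
open import Tactic.RingSolver.Core.AlmostCommutativeRing
  using (AlmostCommutativeRing; fromCommutativeRing)

IsCauchy : (ℕ → ℚ) → Set
IsCauchy x = ∀ ε → 0ℚ ℚ.< ε →
  ∃[ n₀ ] ∀ m n → n₀ ℕ.≤ m → n₀ ℕ.≤ n → ∣ x m ℚ.- x n ∣ ℚ.< ε

record ℝ : Set where
  constructor _,ᶜ_
  field
    seq    : ℕ → ℚ
    cauchy : IsCauchy seq

open ℝ public

infix 4 _≈ℝ_ _<ℝ_

_≈ℝ_ : ℝ → ℝ → Set
x ≈ℝ y = ∀ ε → 0ℚ ℚ.< ε →
  ∃[ n₀ ] ∀ n → n₀ ℕ.≤ n → ∣ seq x n ℚ.- seq y n ∣ ℚ.< ε

_<ℝ_ : ℝ → ℝ → Set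
x <ℝ y = ∃[ ε ] 0ℚ ℚ.< ε ×
  (∃[ n₀ ] ∀ n → n₀ ℕ.≤ n → seq x n ℚ.+ ε ℚ.< seq y n)

private
  acr : AlmostCommutativeRing 0ℓ 0ℓ
  acr = fromCommutativeRing ℚ.+-*-commutativeRing (λ q → dec⇒maybe (0ℚ ℚ.≟ q))

  +-diff : ∀ a b c d → (a ℚ.+ b) ℚ.+ ℚ.- (c ℚ.+ d) ≡ (a ℚ.+ ℚ.- c) ℚ.+ (b ℚ.+ ℚ.- d)
  +-diff a b c d = solve (a ∷ b ∷ c ∷ d ∷ []) acr

  neg-diff : ∀ a b → ℚ.- (a ℚ.+ ℚ.- b) ≡ ℚ.- a ℚ.+ ℚ.- (ℚ.- b)
  neg-diff a b = solve (a ∷ b ∷ []) acr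

  *-diff : ∀ a b c d →
    a ℚ.* b ℚ.+ ℚ.- (c ℚ.* d) ≡ a ℚ.* (b ℚ.+ ℚ.- d) ℚ.+ d ℚ.* (a ℚ.+ ℚ.- c)
  *-diff a b c d = solve (a ∷ b ∷ c ∷ d ∷ []) acr

  restore : ∀ a b → a ≡ (a ℚ.+ ℚ.- b) ℚ.+ b
  restore a b = solve (a ∷ b ∷ []) acr

  half-pos : ∀ {ε} → 0ℚ ℚ.< ε → 0ℚ ℚ.< ½ ℚ.* ε
  half-pos {ε} 0<ε = subst (ℚ._< ½ ℚ.* ε) (ℚ.*-zeroʳ ½) (ℚ.*-monoʳ-<-pos ½ 0<ε)

  halves : ∀ ε → ½ ℚ.* ε ℚ.+ ½ ℚ.* ε ≡ ε
  halves ε = trans (sym (ℚ.*-distribʳ-+ ε ½ ½)) (ℚ.*-identityˡ ε)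

  +-cauchy : ∀ {x y} → IsCauchy x → IsCauchy y → IsCauchy (λ n → x n ℚ.+ y n)
  +-cauchy {x} {y} cx cy ε 0<ε with cx (½ ℚ.* ε) (half-pos 0<ε) | cy (½ ℚ.* ε) (half-pos 0<ε)
  ... | n₁ , hx | n₂ , hy = n₁ ℕ.⊔ n₂ , λ m n hm hn → let open ℚ.≤-Reasoning in begin-strict
    ∣ (x m ℚ.+ y m) ℚ.- (x n ℚ.+ y n) ∣
      ≡⟨ cong ∣_∣ (+-diff (x m) (y m) (x n) (y n)) ⟩
    ∣ (x m ℚ.- x n) ℚ.+ (y m ℚ.- y n) ∣
      ≤⟨ ℚ.∣p+q∣≤∣p∣+∣q∣ (x m ℚ.- x n) (y m ℚ.- y n) ⟩
    ∣ x m ℚ.- x n ∣ ℚ.+ ∣ y m ℚ.- y n ∣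
      <⟨ ℚ.+-mono-< (hx m n (ℕ.m⊔n≤o⇒m≤o n₁ n₂ hm) (ℕ.m⊔n≤o⇒m≤o n₁ n₂ hn))
                    (hy m n (ℕ.m⊔n≤o⇒n≤o n₁ n₂ hm) (ℕ.m⊔n≤o⇒n≤o n₁ n₂ hn)) ⟩
    ½ ℚ.* ε ℚ.+ ½ ℚ.* ε
      ≡⟨ halves ε ⟩
    ε ∎

  neg-cauchy : ∀ {x} → IsCauchy x → IsCauchy (λ n → ℚ.- x n)
  neg-cauchy {x} cx ε 0<ε with cx ε 0<ε
  ... | n₀ , h = n₀ , λ m n hm hn → subst (ℚ._< ε)
      (trans (sym (ℚ.∣-p∣≡∣p∣ (x m ℚ.- x n)))
        (cong ∣_∣ (neg-diff (x m) (x n))))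
      (h m n hm hn)

  const-cauchy : ∀ q → IsCauchy (λ _ → q)
  const-cauchy q ε 0<ε = 0 , λ _ _ _ _ →
    subst (ℚ._< ε) (sym (cong ∣_∣ (ℚ.+-inverseʳ q))) 0<ε

  bounded : ∀ {x} → IsCauchy x →
    ∃[ b ] 0ℚ ℚ.< b × (∃[ n₀ ] ∀ n → n₀ ℕ.≤ n → ∣ x n ∣ ℚ.≤ b)
  bounded {x} cx with cx 1ℚ (ℚ.positive⁻¹ 1ℚ)
  ... | n₀ , h = 1ℚ ℚ.+ ∣ x n₀ ∣
               , ℚ.+-mono-<-≤ (ℚ.positive⁻¹ 1ℚ) (ℚ.0≤∣p∣ (x n₀))
               , n₀ , λ n hn → let open ℚ.≤-Reasoning in begin
    ∣ x n ∣
      ≡⟨ cong ∣_∣ (restore (x n) (x n₀)) ⟩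
    ∣ (x n ℚ.- x n₀) ℚ.+ x n₀ ∣
      ≤⟨ ℚ.∣p+q∣≤∣p∣+∣q∣ (x n ℚ.- x n₀) (x n₀) ⟩
    ∣ x n ℚ.- x n₀ ∣ ℚ.+ ∣ x n₀ ∣
      ≤⟨ ℚ.+-monoˡ-≤ ∣ x n₀ ∣ (ℚ.<⇒≤ (h n n₀ hn ℕ.≤-refl)) ⟩
    1ℚ ℚ.+ ∣ x n₀ ∣ ∎

  scaled : ∀ b ε → 0ℚ ℚ.< b → 0ℚ ℚ.< ε → ∃[ δ ] 0ℚ ℚ.< δ × b ℚ.* δ ≡ ε
  scaled b ε 0<b 0<ε = δ , ℚ.positive⁻¹ δ ⦃ δ-pos ⦄ ,
      trans (sym (ℚ.*-assoc b (ℚ.1/ b) ε))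
        (trans (cong (ℚ._* ε) (ℚ.*-inverseʳ b)) (ℚ.*-identityˡ ε))
    where
    instance
      b-pos : ℚ.Positive b
      b-pos = ℚ.positive 0<b
      b-nz : ℚ.NonZero b
      b-nz = ℚ.pos⇒nonZero b
      ε-pos : ℚ.Positive ε
      ε-pos = ℚ.positive 0<ε
    δ : ℚ
    δ = ℚ.1/ b ℚ.* ε
    δ-pos : ℚ.Positive δ
    δ-pos = ℚ.pos*pos⇒pos (ℚ.1/ b) ⦃ ℚ.1/pos⇒pos b ⦄ ε

  mul-≤ : ∀ {p q b δ} → ∣ p ∣ ℚ.≤ b → ∣ q ∣ ℚ.< δ → ∣ p ℚ.* q ∣ ℚ.≤ b ℚ.* δ
  mul-≤ {p} {q} {b} {δ} hp hq = let open ℚ.≤-Reasoning in begin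
    ∣ p ℚ.* q ∣         ≡⟨ ℚ.∣p*q∣≡∣p∣*∣q∣ p q ⟩
    ∣ p ∣ ℚ.* ∣ q ∣     ≤⟨ ℚ.*-monoʳ-≤-nonNeg ∣ q ∣ ⦃ ℚ.∣-∣-nonNeg q ⦄ hp ⟩
    b ℚ.* ∣ q ∣         ≤⟨ ℚ.*-monoˡ-≤-nonNeg b
                             ⦃ ℚ.nonNegative (ℚ.≤-trans (ℚ.0≤∣p∣ p) hp) ⦄ (ℚ.<⇒≤ hq) ⟩
    b ℚ.* δ ∎

  *-estimate : ∀ a b c d {B C δ η} → ∣ a ∣ ℚ.≤ B → ∣ d ∣ ℚ.≤ C →
    ∣ b ℚ.- d ∣ ℚ.< δ → ∣ a ℚ.- c ∣ ℚ.< η →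
    ∣ a ℚ.* b ℚ.- c ℚ.* d ∣ ℚ.≤ B ℚ.* δ ℚ.+ C ℚ.* η
  *-estimate a b c d {B} {C} {δ} {η} ha hd hbd hac = let open ℚ.≤-Reasoning in begin
    ∣ a ℚ.* b ℚ.- c ℚ.* d ∣
      ≡⟨ cong ∣_∣ (*-diff a b c d) ⟩
    ∣ a ℚ.* (b ℚ.- d) ℚ.+ d ℚ.* (a ℚ.- c) ∣
      ≤⟨ ℚ.∣p+q∣≤∣p∣+∣q∣ (a ℚ.* (b ℚ.- d)) (d ℚ.* (a ℚ.- c)) ⟩
    ∣ a ℚ.* (b ℚ.- d) ∣ ℚ.+ ∣ d ℚ.* (a ℚ.- c) ∣
      ≤⟨ ℚ.+-mono-≤ (mul-≤ {a} ha hbd) (mul-≤ {d} hd hac) ⟩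
    B ℚ.* δ ℚ.+ C ℚ.* η ∎

  *-cauchy : ∀ {x y} → IsCauchy x → IsCauchy y → IsCauchy (λ n → x n ℚ.* y n)
  *-cauchy {x} {y} cx cy ε 0<ε =
    let
      B , 0<B , n₁ , hB   = bounded {x} cx
      C , 0<C , n₂ , hC   = bounded {y} cy
      ε′ , 0<ε′ , ε′<ε    = ℚ.<-dense 0<ε
      δ , 0<δ , Bδ        = scaled B (½ ℚ.* ε′) 0<B (half-pos 0<ε′)
      η , 0<η , Cη        = scaled C (½ ℚ.* ε′) 0<C (half-pos 0<ε′)
      n₃ , hx             = cx η 0<η
      n₄ , hy             = cy δ 0<δ
      l : ∀ {i} → (n₁ ℕ.⊔ n₂) ℕ.⊔ (n₃ ℕ.⊔ n₄) ℕ.≤ i → n₁ ℕ.⊔ n₂ ℕ.≤ i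
      l = ℕ.m⊔n≤o⇒m≤o (n₁ ℕ.⊔ n₂) (n₃ ℕ.⊔ n₄)
      r : ∀ {i} → (n₁ ℕ.⊔ n₂) ℕ.⊔ (n₃ ℕ.⊔ n₄) ℕ.≤ i → n₃ ℕ.⊔ n₄ ℕ.≤ i
      r = ℕ.m⊔n≤o⇒n≤o (n₁ ℕ.⊔ n₂) (n₃ ℕ.⊔ n₄)
    in (n₁ ℕ.⊔ n₂) ℕ.⊔ (n₃ ℕ.⊔ n₄) , λ m n hm hn →
      ℚ.≤-<-trans
        (*-estimate (x m) (y m) (x n) (y n)
          (hB m (ℕ.m⊔n≤o⇒m≤o n₁ n₂ (l hm))) (hC n (ℕ.m⊔n≤o⇒n≤o n₁ n₂ (l hn)))
          (hy m n (ℕ.m⊔n≤o⇒n≤o n₃ n₄ (r hm)) (ℕ.m⊔n≤o⇒n≤o n₃ n₄ (r hn)))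
          (hx m n (ℕ.m⊔n≤o⇒m≤o n₃ n₄ (r hm)) (ℕ.m⊔n≤o⇒m≤o n₃ n₄ (r hn))))
        (subst (ℚ._< ε) (sym (trans (cong₂ ℚ._+_ Bδ Cη) (halves ε′))) ε′<ε)

infixl 6 _+ℝ_
infixl 7 _*ℝ_
infix  8 -ℝ_

_+ℝ_ : ℝ → ℝ → ℝ
x +ℝ y = (λ n → seq x n ℚ.+ seq y n) ,ᶜ +-cauchy {seq x} {seq y} (cauchy x) (cauchy y)

_*ℝ_ : ℝ → ℝ → ℝ
x *ℝ y = (λ n → seq x n ℚ.* seq y n) ,ᶜ *-cauchy {seq x} {seq y} (cauchy x) (cauchy y)

-ℝ_ : ℝ → ℝ
-ℝ x = (λ n → ℚ.- seq x n) ,ᶜ neg-cauchy {seq x} (cauchy x)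

fromℚ : ℚ → ℝ
fromℚ q = (λ _ → q) ,ᶜ const-cauchy q

0ℝ 1ℝ : ℝ
0ℝ = fromℚ 0ℚ
1ℝ = fromℚ 1ℚ

ℝ-rawRing : RawRing 0ℓ 0ℓ
ℝ-rawRing = record
  { Carrier = ℝ ; _≈_ = _≈ℝ_ ; _+_ = _+ℝ_ ; _*_ = _*ℝ_ ; -_ = -ℝ_ ; 0# = 0ℝ ; 1# = 1ℝ }

record ℂ : Set where
  constructor _+i_
  field
    re im : ℝ

open ℂ public

infixl 6 _-ℂ_
infixl 7 _*ℂ_

_-ℂ_ : ℂ → ℂ → ℂ
(a +i b) -ℂ (c +i d) = (a +ℝ -ℝ c) +i (b +ℝ -ℝ d)

_*ℂ_ : ℂ → ℂ → ℂ
(a +i b) *ℂ (c +i d) = (a *ℝ c +ℝ -ℝ (b *ℝ d)) +i (a *ℝ d +ℝ b *ℝ c)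

∣_∣² : ℂ → ℝ
∣ a +i b ∣² = a *ℝ a +ℝ b *ℝ b

fromℝ : ℝ → ℂ
fromℝ x = x +i 0ℝ

‖_‖² : ℂ × ℂ → ℝ
‖ z , w ‖² = ∣ z ∣² +ℝ ∣ w ∣²

record ℙ¹ : Set where
  field
    coords  : ℂ × ℂ
    nonzero : 0ℝ <ℝ ‖ coords ‖²

-- The square of the chordal distance
--   |z w′ − z′ w| / (‖(z , w)‖ ‖(z′ , w′)‖)
-- is less than ε, with denominators cleared.  The inequality is strict, so it
-- fails whenever one of the pairs is (0 , 0).
ChordalWithin : ℚ → ℂ × ℂ → ℂ × ℂ → Set
ChordalWithin ε u@(z , w) u′@(z′ , w′) =
  ∣ z *ℂ w′ -ℂ z′ *ℂ w ∣² <ℝ fromℚ ε *ℝ (‖ u ‖² *ℝ ‖ u′ ‖²)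

_TendsTo_ : (ℕ → ℂ × ℂ) → ℙ¹ → Set
u TendsTo p = ∀ ε → 0ℚ ℚ.< ε →
  ∃[ n₀ ] ∀ n → n₀ ℕ.≤ n → ChordalWithin ε (u n) (ℙ¹.coords p)

module Matrices {c ℓ} (R : CommutativeRing c ℓ) where

  open CommutativeRing R renaming (sym to ≈-sym; trans to ≈-trans)
  open import Algebra.Definitions.RawMonoid +-rawMonoid using () renaming (_×_ to _·_)

  record M₂ : Set c where
    constructor mat
    field
      e₁₁ e₁₂ e₂₁ e₂₂ : Carrier

  open M₂ public

  infix  4 _≈ᴹ_
  infixl 7 _*ᴹ_

  record _≈ᴹ_ (A B : M₂) : Set ℓ where
    constructor eq
    field
      eq₁₁ : e₁₁ A ≈ e₁₁ B
      eq₁₂ : e₁₂ A ≈ e₁₂ B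
      eq₂₁ : e₂₁ A ≈ e₂₁ B
      eq₂₂ : e₂₂ A ≈ e₂₂ B

  _*ᴹ_ : M₂ → M₂ → M₂
  mat a b c d *ᴹ mat a′ b′ c′ d′ =
    mat (a * a′ + b * c′) (a * b′ + b * d′)
        (c * a′ + d * c′) (c * b′ + d * d′)

  Iᴹ : M₂
  Iᴹ = mat 1# 0# 0# 1#

  D D⁻¹ : Carrier → M₂
  D   α = mat α 1# 1# 0#
  D⁻¹ α = mat 0# 1# 1# (- α)

  ΠD ΠD⁻¹ : List Carrier → M₂
  ΠD   = foldr (λ α A → D α *ᴹ A) Iᴹ
  ΠD⁻¹ = foldr (λ α A → A *ᴹ D⁻¹ α) Iᴹ

  private
    open import Algebra.Properties.CommutativeSemigroup
      (CommutativeMonoid.commutativeSemigroup +-commutativeMonoid) using (interchange)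
    open import Algebra.Properties.Ring ring using (-‿distribʳ-*; -‿involutive)
    open import Algebra.Properties.AbelianGroup +-abelianGroup using (⁻¹-∙-comm; ε⁻¹≈ε)
    open import Relation.Binary.Reasoning.Setoid setoid

    ≈ᴹ-trans : ∀ {A B C} → A ≈ᴹ B → B ≈ᴹ C → A ≈ᴹ C
    ≈ᴹ-trans (eq p q r s) (eq p′ q′ r′ s′) =
      eq (≈-trans p p′) (≈-trans q q′) (≈-trans r r′) (≈-trans s s′)

    ≈ᴹ-sym : ∀ {A B} → A ≈ᴹ B → B ≈ᴹ A
    ≈ᴹ-sym (eq p q r s) = eq (≈-sym p) (≈-sym q) (≈-sym r) (≈-sym s)

    *ᴹ-congʳ : ∀ A {B C} → B ≈ᴹ C → A *ᴹ B ≈ᴹ A *ᴹ C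
    *ᴹ-congʳ A (eq p q r s) =
      eq (+-cong (*-congˡ p) (*-congˡ r)) (+-cong (*-congˡ q) (*-congˡ s))
         (+-cong (*-congˡ p) (*-congˡ r)) (+-cong (*-congˡ q) (*-congˡ s))

    *ᴹ-congˡ : ∀ A {B C} → B ≈ᴹ C → B *ᴹ A ≈ᴹ C *ᴹ A
    *ᴹ-congˡ A (eq p q r s) =
      eq (+-cong (*-congʳ p) (*-congʳ q)) (+-cong (*-congʳ p) (*-congʳ q))
         (+-cong (*-congʳ r) (*-congʳ s)) (+-cong (*-congʳ r) (*-congʳ s))

    assoc-entry : ∀ a b p q r s x y →
      (a * p + b * r) * x + (a * q + b * s) * y ≈ a * (p * x + q * y) + b * (r * x + s * y)
    assoc-entry a b p q r s x y = begin
      (a * p + b * r) * x + (a * q + b * s) * y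
        ≈⟨ +-cong (distribʳ x _ _) (distribʳ y _ _) ⟩
      (a * p * x + b * r * x) + (a * q * y + b * s * y)
        ≈⟨ interchange _ _ _ _ ⟩
      (a * p * x + a * q * y) + (b * r * x + b * s * y)
        ≈⟨ +-cong (+-cong (*-assoc _ _ _) (*-assoc _ _ _))
                  (+-cong (*-assoc _ _ _) (*-assoc _ _ _)) ⟩
      (a * (p * x) + a * (q * y)) + (b * (r * x) + b * (s * y))
        ≈⟨ +-cong (distribˡ a _ _) (distribˡ b _ _) ⟨
      a * (p * x + q * y) + b * (r * x + s * y) ∎

    *ᴹ-assoc : ∀ A B C → (A *ᴹ B) *ᴹ C ≈ᴹ A *ᴹ (B *ᴹ C)
    *ᴹ-assoc A B C = eq
      (assoc-entry _ _ _ _ _ _ _ _) (assoc-entry _ _ _ _ _ _ _ _)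
      (assoc-entry _ _ _ _ _ _ _ _) (assoc-entry _ _ _ _ _ _ _ _)

    1-0 : ∀ x y → 1# * x + 0# * y ≈ x
    1-0 x y = ≈-trans (+-cong (*-identityˡ x) (zeroˡ y)) (+-identityʳ x)

    0-1 : ∀ x y → 0# * x + 1# * y ≈ y
    0-1 x y = ≈-trans (+-cong (zeroˡ x) (*-identityˡ y)) (+-identityˡ y)

    *ᴹ-identityˡ : ∀ A → Iᴹ *ᴹ A ≈ᴹ A
    *ᴹ-identityˡ A = eq (1-0 _ _) (1-0 _ _) (0-1 _ _) (0-1 _ _)

    D-inverseʳ : ∀ α → D α *ᴹ D⁻¹ α ≈ᴹ Iᴹ
    D-inverseʳ α = eq
      (≈-trans (+-cong (zeroʳ α) (*-identityˡ 1#)) (+-identityˡ 1#))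
      (≈-trans (+-cong (*-identityʳ α) (*-identityˡ (- α))) (-‿inverseʳ α))
      (1-0 0# 1#)
      (1-0 1# (- α))

  ΠD-inverseʳ : ∀ αs → ΠD αs *ᴹ ΠD⁻¹ αs ≈ᴹ Iᴹ
  ΠD-inverseʳ [] = *ᴹ-identityˡ Iᴹ
  ΠD-inverseʳ (α ∷ αs) =
    ≈ᴹ-trans (*ᴹ-assoc (D α) A (A⁻¹ *ᴹ D⁻¹ α))
      (≈ᴹ-trans (*ᴹ-congʳ (D α) (≈ᴹ-trans (≈ᴹ-sym (*ᴹ-assoc A A⁻¹ (D⁻¹ α)))
          (≈ᴹ-trans (*ᴹ-congˡ (D⁻¹ α) (ΠD-inverseʳ αs)) (*ᴹ-identityˡ (D⁻¹ α)))))
        (D-inverseʳ α))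
    where
    A   = ΠD αs
    A⁻¹ = ΠD⁻¹ αs

  -- quad a b c stands for a x² + b x + c
  record Quadratic : Set c where
    constructor quad
    field
      x² x¹ x⁰ : Carrier

  discriminant : Quadratic → Carrier
  discriminant (quad a b c) = b * b - 4 · (a * c)

  discriminant-formula : ∀ t u v →
    discriminant (quad v t (- u)) ≈ t * t + 4 · (u * v)
  discriminant-formula t u v = +-congˡ (begin
    - (4 · (v * - u))   ≈⟨ -‿· 4 (v * - u) ⟩
    4 · (- (v * - u))   ≈⟨ ·-congʳ 4 (-‿cong (-‿distribʳ-* v u)) ⟨
    4 · (- - (v * u))   ≈⟨ ·-congʳ 4 (≈-trans (-‿involutive _) (*-comm v u)) ⟩
    4 · (u * v) ∎)
    where
    -‿· : ∀ n x → - (n · x) ≈ n · (- x)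
    -‿· zero    x = ε⁻¹≈ε
    -‿· (suc n) x = ≈-trans (≈-sym (⁻¹-∙-comm x (n · x))) (+-congˡ (-‿· n x))
    ·-congʳ : ∀ n {x y} → x ≈ y → n · x ≈ n · y
    ·-congʳ zero    p = refl
    ·-congʳ (suc n) p = +-cong p (·-congʳ n p)

  -- The recurrence u₍ₙ₊₁₎ = a₍ₙ₊₁₎ uₙ + u₍ₙ₋₁₎ with given u₋₁ and u₀.
  recurrence : (ℕ → Carrier) → Carrier → Carrier → ℕ → Carrier
  recurrence a u₋₁ u₀ 0 = u₀
  recurrence a u₋₁ u₀ 1 = a 1 * u₀ + u₋₁
  recurrence a u₋₁ u₀ (suc (suc n)) =
    a (suc (suc n)) * recurrence a u₋₁ u₀ (suc n) + recurrence a u₋₁ u₀ n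

-- A field of degree 2 over ℚ (with basis b₁ , b₂) together with an embedding σ
-- into ℝ, through which its elements are compared with 0.
record RealQuadraticField (c ℓ : Level) : Set (lsuc (c ⊔ ℓ)) where
  field
    commutativeRing : CommutativeRing c ℓ

  open CommutativeRing commutativeRing public

  field
    inverse : ∀ x → ¬ x ≈ 0# → ∃[ y ] x * y ≈ 1#

    ι       : ℚ → Carrier
    ι-isRingHomomorphism : IsRingHomomorphism ℚ.+-*-rawRing rawRing ι

    b₁ b₂   : Carrier
    spanning : ∀ x → ∃[ p ] ∃[ q ] x ≈ ι p * b₁ + ι q * b₂
    independent : ∀ p q → ι p * b₁ + ι q * b₂ ≈ 0# → p ≡ 0ℚ × q ≡ 0ℚ

    σ       : Carrier → ℝ
    σ-isRingHomomorphism : IsRingHomomorphism rawRing ℝ-rawRing σ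

  -- The value at x of the monic polynomial whose coefficients below the
  -- leading one are cs, the constant term first.
  evalMonic : List ℤ → Carrier → Carrier
  evalMonic []       x = 1#
  evalMonic (c ∷ cs) x = ι (c ℚ./ 1) + x * evalMonic cs x

  IsAlgebraicInteger : Carrier → Set ℓ
  IsAlgebraicInteger x = ∃[ cs ] evalMonic cs x ≈ 0#

  IsSquare : Carrier → Set (c ⊔ ℓ)
  IsSquare x = ∃[ y ] y * y ≈ x

  Positive Negative : Carrier → Set
  Positive x = 0ℝ <ℝ σ x
  Negative x = σ x <ℝ 0ℝ

module _ {c ℓ} (K : RealQuadraticField c ℓ) where

  open RealQuadraticField K

  -- [a₀,…,a_N, \overline{a_{N+1},…,a_{N+k}}], given as the infinite sequence of
  -- its partial quotients; k need not be the least period.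
  record PeriodicCF : Set (c ⊔ ℓ) where
    field
      N k      : ℕ
      k≥1      : 1 ℕ.≤ k
      a        : ℕ → Carrier
      periodic : ∀ i → N ℕ.< i → a (i ℕ.+ k) ≈ a i
      nonzero  : ∀ i → 1 ℕ.≤ i → ¬ a i ≈ 0#

module PCF {c ℓ} {K : RealQuadraticField c ℓ} (P : PeriodicCF K) where

  open RealQuadraticField K
  open import Algebra.Definitions.RawMonoid +-rawMonoid using () renaming (_×_ to _·_)
  open Matrices commutativeRing
  open PeriodicCF P

  preperiod period : List Carrier
  preperiod = applyUpTo a (suc N)
  period    = applyUpTo (λ i → a (suc N ℕ.+ i)) k

  E : M₂
  E = (ΠD preperiod *ᴹ ΠD period) *ᴹ ΠD⁻¹ preperiod

  f : Quadratic
  f = quad (e₂₁ E) (e₂₂ E - e₁₁ E) (- e₁₂ E)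

  Δ : Carrier
  Δ = (e₂₂ E - e₁₁ E) * (e₂₂ E - e₁₁ E) + 4 · (e₁₂ E * e₂₁ E)

  discriminant-f≈Δ : discriminant f ≈ Δ
  discriminant-f≈Δ = discriminant-formula (e₂₂ E - e₁₁ E) (e₁₂ E) (e₂₁ E)

  numerator denominator : ℕ → Carrier
  numerator   = recurrence a 1# (a 0)
  denominator = recurrence a 0# 1#

  -- Homogeneous coordinates of Pₙ/Qₙ.  They are never both zero, because
  -- PₙQₙ₋₁ − Pₙ₋₁Qₙ = ±1; the denominator alone may vanish.
  convergent : ℕ → ℂ × ℂ
  convergent n = fromℝ (σ (numerator n)) , fromℝ (σ (denominator n))

  Converges : Set
  Converges = ∃[ p ] convergent TendsTo p

{-# OPTIONS --safe #-}

-- For n ≥ N the vectors vₙ = (Pₙ , Qₙ) satisfy vₙ₊ₖ = E vₙ, with det E = ±1 and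
-- Δ = (tr E)² − 4 det E.
--
-- Δ > 0, not a square: tr E ≠ 0, since otherwise Δ = −4 det E would be −4 or the
-- square 4; hence the real eigenvalues λ± = (tr E ± √Δ) / 2, whose product is
-- ±1, have different absolute values.  The linear forms w± that vanish on the
-- eigenlines are multiplied by λ± under E, and w₊ w₋ is a quadratic form over K
-- without nontrivial zeros because Δ is not a square.  So w₊ and w₋ do not
-- vanish on vₙ, one of them grows and the other decays along each residue class
-- mod k, and vₙ tends to the dominant eigenline.
--
-- Δ < 0: the form det (v , E v) of discriminant Δ is definite, so the chordal
-- distance between v and E v is bounded below, and vₙ is not Cauchy.
module Submission where

open import Algebra.Bundles using (CommutativeRing; RawRing)
import Algebra.Definitions.RawMonoid
open import Algebra.Morphism.Structures using (IsRingHomomorphism)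
import Algebra.Solver.Ring
open import Algebra.Solver.Ring.AlmostCommutativeRing
  using (fromCommutativeRing; _-Raw-AlmostCommutative⟶_)
open import Data.Empty using (⊥)
open import Data.Integer.Base as ℤ using (+_)
import Data.Integer.Properties as ℤ
open import Data.List.Base using ([]; _∷_; applyUpTo)
import Data.Maybe.Base as Maybe
open import Data.Nat.Base as ℕ using (ℕ; zero; suc)
import Data.Nat.DivMod as ℕ
import Data.Nat.Properties as ℕ
open import Data.Product.Base using (∃; ∃-syntax; _×_; _,_; proj₁; proj₂)
open import Data.Rational.Base as ℚ using (ℚ; 0ℚ; 1ℚ)
import Data.Rational.Properties as ℚ
import Data.Rational.Unnormalised.Base as ℚᵘ
import Data.Rational.Unnormalised.Properties as ℚᵘ
open import Data.Sum.Base using (_⊎_; inj₁; inj₂; [_,_]′)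
open import Level using (Level; 0ℓ)
open import Relation.Binary.Bundles using (Setoid)
open import Relation.Binary.PropositionalEquality as ≡ using (_≡_)
open import Relation.Binary.Structures using (IsEquivalence)
open import Relation.Nullary using (¬_; Dec; yes; no; contradiction)
open import Relation.Nullary.Decidable using (dec⇒maybe)
open import Relation.Unary using (Decidable)
import Tactic.RingSolver.Core.AlmostCommutativeRing as Tactic
open import Defs

-- Equality and order of the constructive reals are undecidable. For Δ > 0 every nonvanishing is
-- therefore proved in `K`, where equality is decidable, and is carried over by `σ`: a nonzero
-- element of `K` is a unit, so the square of its image has a positive lower bound. Over the ordered
-- ring only strict positivity occurs. An inequality is proved by a polynomial identity that writes
-- the quantity, perhaps times a positive factor, as a positive term plus squares; the factor is
-- then cancelled, which takes the place of division.
--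
-- The eigenvalues are compared through λ₊² - λ₋² = (tr E) s with s² = Δ, so no absolute values are
-- needed: it suffices to give s the sign of the trace. Convergence is measured on squares, since
-- w₋² is the numerator of the squared chordal distance to the attracting eigenline, and w₊² bounds
-- the norm of the vector from below.

Eventually : (ℕ → Set) → Set
Eventually P = ∃[ n₀ ] ∀ n → n₀ ℕ.≤ n → P n

always : {P : ℕ → Set} → (∀ n → P n) → Eventually P
always h = 0 , λ n _ → h n

ev-map : {P Q : ℕ → Set} → (∀ n → P n → Q n) → Eventually P → Eventually Q
ev-map f (n₀ , h) = n₀ , λ n n₀≤n → f n (h n n₀≤n)

ev-zip : {P Q R : ℕ → Set} → (∀ n → P n → Q n → R n) →
  Eventually P → Eventually Q → Eventually R
ev-zip f (m₀ , h) (n₀ , k) = m₀ ℕ.⊔ n₀ , λ n hn →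
  f n (h n (ℕ.m⊔n≤o⇒m≤o m₀ n₀ hn)) (k n (ℕ.m⊔n≤o⇒n≤o m₀ n₀ hn))

bounded-max : ∀ (f : ℕ → ℕ) k → ∃[ b ] ∀ r → r ℕ.< k → f r ℕ.≤ b
bounded-max f zero    = 0 , λ _ ()
bounded-max f (suc k) =
  let b , h = bounded-max f k
  in b ℕ.⊔ f k , λ r r<1+k → [ (λ r<k → ℕ.≤-trans (h r r<k) (ℕ.m≤m⊔n b (f k)))
                             , (λ where ≡.refl → ℕ.m≤n⊔m b (f k)) ]′ (ℕ.m<1+n⇒m<n∨m≡n r<1+k)

-- Every `n` ≥ `N` is `N + r + q * k` with `r < k`. The finitely many residues have a common bound
-- `b` on their thresholds, and `n` ≥ `N + b * k` forces `q` ≥ `b`.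
eventually-by-residues : ∀ {P : ℕ → Set} N k → 1 ℕ.≤ k →
  (∀ m → N ℕ.≤ m → Eventually λ j → P (m ℕ.+ j ℕ.* k)) → Eventually P
eventually-by-residues {P} N k@(suc _) _ h = N ℕ.+ b ℕ.* k , λ n le →
  let q = (n ℕ.∸ N) ℕ./ k
      r = (n ℕ.∸ N) ℕ.% k
      r<k = ℕ.m%n<n (n ℕ.∸ N) k
      b*k≤n-N = ℕ.≤-trans (ℕ.≤-reflexive (≡.sym (ℕ.m+n∸m≡n N (b ℕ.* k)))) (ℕ.∸-monoˡ-≤ N le)
      n≡ = ≡.trans (ℕ.+-assoc N r (q ℕ.* k))
            (≡.trans (≡.cong (N ℕ.+_) (≡.sym (ℕ.m≡m%n+[m/n]*n (n ℕ.∸ N) k)))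
              (ℕ.m+[n∸m]≡n (ℕ.m+n≤o⇒m≤o N le)))
  in ≡.subst P n≡ (proj₂ (start r) q (ℕ.≤-trans (proj₂ max r r<k)
       (ℕ.≤-trans (ℕ.≤-reflexive (≡.sym (ℕ.m*n/n≡m b k))) (ℕ./-monoˡ-≤ k b*k≤n-N))))
  where
  start : ∀ r → Eventually λ j → P (N ℕ.+ r ℕ.+ j ℕ.* k)
  start r = h (N ℕ.+ r) (ℕ.m≤m+n N r)
  max : ∃[ b ] ∀ r → r ℕ.< k → proj₁ (start r) ℕ.≤ b
  max = bounded-max (λ r → proj₁ (start r)) k
  b : ℕ
  b = proj₁ max

-- The solver compares coefficients only. Taking them from ℚ makes it usable over ℝ, whose equality
-- is undecidable, and admits the coefficient ½.
module ℚ-AlgebraSolver {c ℓ} (R : CommutativeRing c ℓ) (ι : ℚ → CommutativeRing.Carrier R)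
  (ι-isRingHomomorphism :
    IsRingHomomorphism ℚ.+-*-rawRing (CommutativeRing.rawRing R) ι) where

  open IsRingHomomorphism ι-isRingHomomorphism

  morphism : ℚ.+-*-rawRing -Raw-AlmostCommutative⟶ fromCommutativeRing R
  morphism = record
    { ⟦_⟧ = ι ; +-homo = +-homo ; *-homo = *-homo ; -‿homo = -‿homo
    ; 0-homo = 0#-homo ; 1-homo = 1#-homo }

  open Algebra.Solver.Ring ℚ.+-*-rawRing (fromCommutativeRing R) morphism
    (λ p q → Maybe.map ⟦⟧-cong (dec⇒maybe (p ℚ.≟ q)))
    public using (solve; _:=_; con; _:+_; _:*_; :-_; _:-_)

  open CommutativeRing R
  open import Algebra.Definitions.RawMonoid +-rawMonoid using () renaming (_×_ to _·_)

  4·≈4* : ∀ x → 4 · x ≈ ι (+ 4 ℚ./ 1) * x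
  4·≈4* x = trans (+-congˡ (+-congˡ (+-congˡ (+-identityʳ x))))
    (solve 1 (λ x → x :+ (x :+ (x :+ x)) := con (+ 4 ℚ./ 1) :* x) refl x)

-- Plane dynamics over an ordered ring

-- What the proof uses of ℝ.  Working over an abstract carrier keeps the equality
-- opaque; _≈ℝ_ unfolds to a function type, from which x and y cannot be inferred.
record OrderedAlgebra : Set₁ where
  field
    commutativeRing : CommutativeRing 0ℓ 0ℓ
  open CommutativeRing commutativeRing public
  -- j ×* q is the power qʲ.
  open Algebra.Definitions.RawMonoid *-rawMonoid using () renaming (_×_ to _×*_)
  field
    ι : ℚ → Carrier
    ι-isRingHomomorphism : IsRingHomomorphism ℚ.+-*-rawRing rawRing ι
    Pos : Carrier → Set
    pos-resp : ∀ {x y} → x ≈ y → Pos x → Pos y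
    pos-+ : ∀ {x y} → Pos x → Pos y → Pos (x + y)
    pos-* : ∀ {x y} → Pos x → Pos y → Pos (x * y)
    pos-+² : ∀ {x} y → Pos x → Pos (x + y * y)
    ¬pos-0 : ¬ Pos 0#
    pos-ι : ∀ {q} → 0ℚ ℚ.< q → Pos (ι q)
    pos-cancel² : ∀ {x} y → Pos (x * (y * y)) → Pos x
    sign : ∀ {x} → Pos (x * x) → Pos x ⊎ Pos (- x)
    growth : ∀ {q b} a → Pos (q - 1#) → Pos b →
      ∃[ j₀ ] ∀ j → j₀ ℕ.≤ j → Pos ((j ×* q) * b - a)
    small-multiple : ∀ {y} x → Pos y → ∃[ ε ] 0ℚ ℚ.< ε × Pos (y - ι ε * x)
    square-root : ∀ {x} → Pos x → ∃[ s ] s * s ≈ x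

module OrderedProperties (A : OrderedAlgebra) where

  open OrderedAlgebra A public
  open ℚ-AlgebraSolver commutativeRing ι ι-isRingHomomorphism public
  open IsRingHomomorphism ι-isRingHomomorphism

  pos-lit : ∀ n → .⦃ _ : ℕ.NonZero n ⦄ → Pos (ι (+ n ℚ./ 1))
  pos-lit n@(suc _) = pos-ι (ℚ.positive⁻¹ (+ n ℚ./ 1) ⦃ ℚ.normalize-pos n 1 ⦄)

  pos-cancel : ∀ {x y} → Pos y → Pos (x * y) → Pos x
  pos-cancel {x} {y} hy hxy = pos-cancel² y (pos-resp (*-assoc x y y) (pos-* hxy hy))

  -- Multiplication by `y` turns the second summand into the square of `y * z`, so that `pos-+²`
  -- applies.
  pos-+*² : ∀ {x y} z → Pos x → Pos y → Pos (x + y * (z * z))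
  pos-+*² {x} {y} z hx hy = pos-cancel hy (pos-resp
    (solve 3 (λ x y z → x :* y :+ (y :* z) :* (y :* z) := (x :+ y :* (z :* z)) :* y) refl x y z)
    (pos-+² (y * z) (pos-* hx hy)))

  unit⇒square-pos : ∀ {x y} → x * y ≈ 1# → Pos (x * x)
  unit⇒square-pos {x} {y} xy≈1 = pos-cancel² y (pos-resp
    (trans (sym (trans (*-cong xy≈1 xy≈1) (*-identityˡ 1#)))
      (solve 2 (λ x y → (x :* y) :* (x :* y) := (x :* x) :* (y :* y)) refl x y))
    (pos-resp 1#-homo (pos-ι (ℚ.positive⁻¹ 1ℚ))))

  2ι 4ι 64ι : Carrier
  2ι  = ι (+ 2 ℚ./ 1)
  4ι  = ι (+ 4 ℚ./ 1)
  64ι = ι (+ 64 ℚ./ 1)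

  norm² : Carrier → Carrier → Carrier
  norm² x y = x * x + y * y

  det : Carrier → Carrier → Carrier → Carrier → Carrier
  det x y x′ y′ = x * y′ - x′ * y

  -- ChordalWithin for a real and a complex pair, the latter being
  -- (z₁ + i z₂ , w₁ + i w₂).
  Close : Carrier → (x y z₁ z₂ w₁ w₂ : Carrier) → Set
  Close e x y z₁ z₂ w₁ w₂ = Pos
    (e * (norm² x y * (norm² z₁ z₂ + norm² w₁ w₂))
      - (det x y z₁ w₁ * det x y z₁ w₁ + det x y z₂ w₂ * det x y z₂ w₂))

  close-resp : ∀ {e x x′ y y′ z₁ z₂ w₁ w₂} → x ≈ x′ → y ≈ y′ →
    Close e x y z₁ z₂ w₁ w₂ → Close e x′ y′ z₁ z₂ w₁ w₂
  close-resp {z₁ = z₁} {z₂} {w₁} {w₂} x≈ y≈ = pos-resp (+-cong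
    (*-congˡ (*-congʳ (+-cong (*-cong x≈ x≈) (*-cong y≈ y≈))))
    (-‿cong (+-cong (*-cong (h z₁ w₁) (h z₁ w₁)) (*-cong (h z₂ w₂) (h z₂ w₂)))))
    where
    h : ∀ z w → det _ _ z w ≈ det _ _ z w
    h z w = +-cong (*-congʳ x≈) (-‿cong (*-congˡ y≈))

  -- The strict inequality puts e · norm² · norm² above a sum of squares; a zero vector is close to
  -- nothing.
  close⇒norm-pos : ∀ {e x y z₁ z₂ w₁ w₂} → Pos e → Pos (norm² z₁ z₂ + norm² w₁ w₂) →
    Close e x y z₁ z₂ w₁ w₂ → Pos (norm² x y)
  close⇒norm-pos {e} {x} {y} {z₁} {z₂} {w₁} {w₂} he hp h =
    pos-cancel (pos-* he hp) (pos-resp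
      (solve 5 (λ e n p d₁ d₂ → (e :* (n :* p) :- (d₁ :* d₁ :+ d₂ :* d₂)) :+ d₁ :* d₁ :+ d₂ :* d₂
          := n :* (e :* p)) refl e (norm² x y) (norm² z₁ z₂ + norm² w₁ w₂) (det x y z₁ w₁) (det x y z₂ w₂))
      (pos-+² (det x y z₂ w₂) (pos-+² (det x y z₁ w₁) h)))

  -- Parallelogram law for the two terms of  det u u′ · q = det q u′ · u + det u q · u′.
  plücker : ∀ x y x′ y′ z w →
    norm² (det x′ y′ z w * x + det x y z w * x′) (det x′ y′ z w * y + det x y z w * y′)
      + (det x y x′ y′ * det x y x′ y′) * norm² z w
    ≈ 2ι * (norm² x′ y′ * (det x y z w * det x y z w) + norm² x y * (det x′ y′ z w * det x′ y′ z w))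
  plücker = solve 6 (λ x y x′ y′ z w →
    let δ = x :* w :- z :* y ; δ′ = x′ :* w :- z :* y′ ; f = x :* y′ :- x′ :* y
        a = δ′ :* x :+ δ :* x′ ; b = δ′ :* y :+ δ :* y′
    in (a :* a :+ b :* b) :+ (f :* f) :* (z :* z :+ w :* w)
       := con (+ 2 ℚ./ 1) :* ((x′ :* x′ :+ y′ :* y′) :* (δ :* δ) :+ (x :* x :+ y :* y) :* (δ′ :* δ′)))
    refl

  -- Triangle inequality for the chordal distance: two points within √e of a third are within 2√e of
  -- each other, whence the 4 on squares. The real and the imaginary part of the third point use one
  -- instance of `plücker` each, whose parallelogram squares are added to complete the identity.
  close⇒det-bound : ∀ {e x y x′ y′ z₁ z₂ w₁ w₂} → Pos e → Pos (norm² z₁ z₂ + norm² w₁ w₂) →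
    Close e x y z₁ z₂ w₁ w₂ → Close e x′ y′ z₁ z₂ w₁ w₂ →
    Pos (4ι * (e * (norm² x y * norm² x′ y′)) - det x y x′ y′ * det x y x′ y′)
  close⇒det-bound {e} {x} {y} {x′} {y′} {z₁} {z₂} {w₁} {w₂} he hp h h′ =
    pos-cancel hp (pos-resp eq
      (add z₂ w₂ (add z₁ w₁ (pos-+ (pos-* (pos-* (pos-lit 2) n′-pos) h)
                                   (pos-* (pos-* (pos-lit 2) n-pos) h′)))))
    where
    n n′ f p : Carrier
    n  = norm² x y
    n′ = norm² x′ y′
    f  = det x y x′ y′
    p  = norm² z₁ z₂ + norm² w₁ w₂
    n-pos : Pos n
    n-pos = close⇒norm-pos he hp h
    n′-pos : Pos n′
    n′-pos = close⇒norm-pos he hp h′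
    square : Carrier → Carrier → Carrier
    square z w = norm² (det x′ y′ z w * x + det x y z w * x′) (det x′ y′ z w * y + det x y z w * y′)
    add : ∀ {t} z w → Pos t → Pos (t + square z w)
    add z w ht = pos-resp (+-assoc _ _ _) (pos-+² _ (pos-+² _ ht))
    square≈ : ∀ z w → square z w ≈ 2ι * (n′ * (det x y z w * det x y z w)
                + n * (det x′ y′ z w * det x′ y′ z w)) - (f * f) * norm² z w
    square≈ z w = trans
      (solve 2 (λ s t → s := (s :+ t) :- t) refl (square z w) ((f * f) * norm² z w))
      (+-congʳ (plücker x y x′ y′ z w))
    eq : (2ι * n′) * (e * (n * p) - (det x y z₁ w₁ * det x y z₁ w₁ + det x y z₂ w₂ * det x y z₂ w₂))
       + (2ι * n) * (e * (n′ * p) - (det x′ y′ z₁ w₁ * det x′ y′ z₁ w₁ + det x′ y′ z₂ w₂ * det x′ y′ z₂ w₂))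
       + square z₁ w₁ + square z₂ w₂
      ≈ (4ι * (e * (n * n′)) - f * f) * p
    eq = trans (+-cong (+-congˡ (square≈ z₁ w₁)) (square≈ z₂ w₂))
      (solve 12 (λ e n n′ f z₁ z₂ w₁ w₂ d₁ d₂ d₁′ d₂′ →
        let two = con (+ 2 ℚ./ 1)
            q₁ = z₁ :* z₁ :+ z₂ :* z₂ ; q₂ = w₁ :* w₁ :+ w₂ :* w₂
            p = q₁ :+ q₂ in
        (two :* n′) :* (e :* (n :* p) :- (d₁ :* d₁ :+ d₂ :* d₂))
        :+ (two :* n) :* (e :* (n′ :* p) :- (d₁′ :* d₁′ :+ d₂′ :* d₂′))
        :+ (two :* (n′ :* (d₁ :* d₁) :+ n :* (d₁′ :* d₁′)) :- (f :* f) :* (z₁ :* z₁ :+ w₁ :* w₁))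
        :+ (two :* (n′ :* (d₂ :* d₂) :+ n :* (d₂′ :* d₂′)) :- (f :* f) :* (z₂ :* z₂ :+ w₂ :* w₂))
        := (con (+ 4 ℚ./ 1) :* (e :* (n :* n′)) :- f :* f) :* p)
        refl e n n′ f z₁ z₂ w₁ w₂ (det x y z₁ w₁) (det x y z₂ w₂) (det x′ y′ z₁ w₁) (det x′ y′ z₂ w₂))

  open import Algebra.Definitions.RawMonoid +-rawMonoid using () renaming (_×_ to _·_)
  open import Algebra.Definitions.RawMonoid *-rawMonoid using () renaming (_×_ to _×*_)
  open import Relation.Binary.Reasoning.Setoid setoid

  module LinearMap (e₁₁ e₁₂ e₂₁ e₂₂ : Carrier) where

    Δ t : Carrier
    Δ = (e₂₂ - e₁₁) * (e₂₂ - e₁₁) + 4 · (e₁₂ * e₂₁)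
    t = e₁₁ + e₂₂

    actˣ actʸ : Carrier → Carrier → Carrier
    actˣ x y = e₁₁ * x + e₁₂ * y
    actʸ x y = e₂₁ * x + e₂₂ * y

    -- The form e₂₁ x² + (e₂₂ − e₁₁) x y − e₁₂ y².
    f : Carrier → Carrier → Carrier
    f x y = det x y (actˣ x y) (actʸ x y)

    -- 4 e₂₁ f, with the square completed.
    Φ : Carrier → Carrier → Carrier
    Φ x y = ((e₂₁ + e₂₁) * x + (e₂₂ - e₁₁) * y) * ((e₂₁ + e₂₁) * x + (e₂₂ - e₁₁) * y) - Δ * (y * y)

    private
      -- `F` is the squared Frobenius norm of the matrix, `S` the trace of the symmetric matrix of
      -- `f`. The 64 is 4 from the triangle inequality times 16 from squaring 4 S f.
      F S X : Carrier
      F = norm² e₁₁ e₁₂ + norm² e₂₁ e₂₂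
      S = e₂₁ - e₁₂
      X = 64ι * (F * (S * S))

    module _ (Δ<0 : Pos (- Δ)) {e x y z₁ z₂ w₁ w₂ : Carrier}
             (0<e : Pos e) (0<p : Pos (norm² z₁ z₂ + norm² w₁ w₂))
             (small : Pos (Δ * Δ - e * X))
             (close  : Close e x y z₁ z₂ w₁ w₂)
             (close′ : Close e (actˣ x y) (actʸ x y) z₁ z₂ w₁ w₂) where

      private
        n g₁ g₂ G : Carrier
        n = norm² x y
        g₁ = (e₂₁ + e₂₁) * x + (e₂₂ - e₁₁) * y
        g₂ = (e₂₂ - e₁₁) * x - (e₁₂ + e₁₂) * y
        -- G = 4 (e₂₁ − e₁₂) f, which exhibits f as definite.
        G = - Δ * n + g₁ * g₁ + g₂ * g₂

        0<n : Pos n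
        0<n = close⇒norm-pos 0<e 0<p close

        -- Cauchy-Schwarz gives |E v|² ≤ F |v|². By Lagrange's identity the defect is the sum of the
        -- squares of `l₁` and `l₂`, one for each row.
        f-bound : Pos (4ι * (e * (F * (n * n))) - f x y * f x y)
        f-bound = pos-resp
          (solve 8 (λ e e₁₁ e₁₂ e₂₁ e₂₂ x y f →
            let n = x :* x :+ y :* y
                x′ = e₁₁ :* x :+ e₁₂ :* y ; y′ = e₂₁ :* x :+ e₂₂ :* y
                l₁ = e₁₁ :* y :- e₁₂ :* x ; l₂ = e₂₁ :* y :- e₂₂ :* x
                four = con (+ 4 ℚ./ 1) in
            (four :* (e :* (n :* (x′ :* x′ :+ y′ :* y′))) :- f :* f)
              :+ (four :* (e :* n)) :* (l₁ :* l₁) :+ (four :* (e :* n)) :* (l₂ :* l₂)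
            := four :* (e :* (((e₁₁ :* e₁₁ :+ e₁₂ :* e₁₂) :+ (e₂₁ :* e₂₁ :+ e₂₂ :* e₂₂)) :* (n :* n))) :- f :* f)
            refl e e₁₁ e₁₂ e₂₁ e₂₂ x y (f x y))
          (pos-+*² (e₂₁ * y - e₂₂ * x)
            (pos-+*² (e₁₁ * y - e₁₂ * x) (close⇒det-bound 0<e 0<p close close′) 4en) 4en)
          where
          4en : Pos (4ι * (e * n))
          4en = pos-* (pos-lit 4) (pos-* 0<e 0<n)

        -- The sum of two completed squares, 4 e₂₁ f = g₁² - Δ y² and -4 e₁₂ f = g₂² - Δ x². Adding
        -- them avoids a choice between the two diagonal coefficients.
        G≈ : G ≈ (4ι * f x y) * S
        G≈ = trans (+-congʳ (+-congʳ (*-congʳ (-‿cong (+-congˡ (4·≈4* (e₁₂ * e₂₁)))))))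
          (solve 6 (λ e₁₁ e₁₂ e₂₁ e₂₂ x y →
            let four = con (+ 4 ℚ./ 1) ; b = e₂₂ :- e₁₁ ; Δ = b :* b :+ four :* (e₁₂ :* e₂₁)
                g₁ = (e₂₁ :+ e₂₁) :* x :+ b :* y ; g₂ = b :* x :- (e₁₂ :+ e₁₂) :* y in
            :- Δ :* (x :* x :+ y :* y) :+ g₁ :* g₁ :+ g₂ :* g₂
            := (four :* (x :* (e₂₁ :* x :+ e₂₂ :* y) :- (e₁₁ :* x :+ e₁₂ :* y) :* y)) :* (e₂₁ :- e₁₂))
            refl e₁₁ e₁₂ e₂₁ e₂₂ x y)

        0<G : Pos G
        0<G = pos-+² g₂ (pos-+² g₁ (pos-* Δ<0 0<n))

        0<S² : Pos (S * S)
        0<S² = pos-cancel² (4ι * f x y) (pos-resp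
          (trans (*-cong G≈ G≈) (solve 2 (λ a s → (a :* s) :* (a :* s) := (s :* s) :* (a :* a)) refl (4ι * f x y) S))
          (pos-* 0<G 0<G))

        G-bound : Pos ((e * X) * (n * n) - G * G)
        G-bound = pos-resp
          (trans (solve 5 (λ e F n S f →
              (con (+ 16 ℚ./ 1) :* (S :* S)) :* (con (+ 4 ℚ./ 1) :* (e :* (F :* (n :* n))) :- f :* f)
              := (e :* (con (+ 64 ℚ./ 1) :* (F :* (S :* S)))) :* (n :* n)
                 :- ((con (+ 4 ℚ./ 1) :* f) :* S) :* ((con (+ 4 ℚ./ 1) :* f) :* S))
              refl e F n S (f x y))
            (+-congˡ (-‿cong (sym (*-cong G≈ G≈)))))
          (pos-* (pos-* (pos-lit 16) 0<S²) f-bound)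

      -- On one side G ≥ -Δ |v|² gives G² ≥ Δ² |v|⁴, on the other `G-bound` and `small` give G² < Δ²
      -- |v|⁴. The certificate is a sum of positive terms and squares that is identically zero.
      ¬both-close : ⊥
      ¬both-close = ¬pos-0 (pos-resp
        (trans (solve 5 (λ Δ a n g₁ g₂ →
            let g = g₁ :* g₁ :+ g₂ :* g₂ ; G = :- Δ :* n :+ g₁ :* g₁ :+ g₂ :* g₂
                c = con (+ 2 ℚ./ 1) :* (:- Δ :* n) in
            (a :* (n :* n) :- G :* G) :+ c :* (g₁ :* g₁) :+ c :* (g₂ :* g₂) :+ g :* g
              :+ (Δ :* Δ :- a) :* (n :* n)
            := con 0ℚ) refl Δ (e * X) n g₁ g₂) 0#-homo)
        (pos-+ (pos-+² (g₁ * g₁ + g₂ * g₂) (pos-+*² g₂ (pos-+*² g₁ G-bound c) c))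
               (pos-* small (pos-* 0<n 0<n))))
        where
        c : Pos (2ι * (- Δ * n))
        c = pos-* (pos-lit 2) (pos-* Δ<0 0<n)

    -- The bound depends on the matrix alone, so one `ε` refutes every candidate limit.
    separation : Pos (- Δ) → ∃[ ε ] 0ℚ ℚ.< ε × (∀ {x y z₁ z₂ w₁ w₂} →
      Pos (norm² z₁ z₂ + norm² w₁ w₂) → Close (ι ε) x y z₁ z₂ w₁ w₂ →
      ¬ Close (ι ε) (actˣ x y) (actʸ x y) z₁ z₂ w₁ w₂)
    separation Δ<0 =
      let ε , 0<ε , small = small-multiple X (pos-resp
            (solve 1 (λ Δ → :- Δ :* :- Δ := Δ :* Δ) refl Δ) (pos-* Δ<0 Δ<0))
      in ε , 0<ε , λ 0<p → ¬both-close Δ<0 (pos-ι 0<ε) 0<p small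

    -- The eigenvectors of E are (e₁₁ − e₂₂ ± s , 2 e₂₁), with eigenvalues (t ± s) / 2.
    module Eigen (s : Carrier) (s²≈Δ : s * s ≈ Δ) where

      eigen-x eigen-y λ₊ λ₋ : Carrier
      eigen-x = (e₁₁ - e₂₂) + s
      eigen-y = e₂₁ + e₂₁
      λ₊ = ι ℚ.½ * (t + s)
      λ₋ = ι ℚ.½ * (t - s)

      private
        conj-x : Carrier
        conj-x = (e₁₁ - e₂₂) - s

      -- The index of a form names its multiplier, so `w₊` vanishes on the eigenline of `λ₋`, and
      -- `w₋` on that of `λ₊`.
      w₊ w₋ : Carrier → Carrier → Carrier
      w₊ x y = det x y conj-x eigen-y
      w₋ x y = det x y eigen-x eigen-y

      private
        -- The solver treats `s` as a free variable; an identity that holds modulo s² = Δ leaves a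
        -- multiple of Δ - s², which is removed here.
        drop : ∀ a y → a + ι ℚ.½ * ((Δ - s * s) * y) ≈ a
        drop a y = trans
          (+-congˡ (*-congˡ (*-congʳ (trans (+-congˡ (-‿cong s²≈Δ)) (-‿inverseʳ Δ)))))
          (trans (+-congˡ (trans (*-congˡ (zeroˡ y)) (zeroʳ (ι ℚ.½)))) (+-identityʳ a))

        Δ≈ : Δ ≈ (e₂₂ - e₁₁) * (e₂₂ - e₁₁) + 4ι * (e₁₂ * e₂₁)
        Δ≈ = +-congˡ (4·≈4* (e₁₂ * e₂₁))

      w₊-act : ∀ x y → w₊ (actˣ x y) (actʸ x y) ≈ λ₊ * w₊ x y
      w₊-act x y = trans
        (solve 7 (λ e₁₁ e₁₂ e₂₁ e₂₂ s x y →
          let b = e₂₂ :- e₁₁ ; Δ = b :* b :+ con (+ 4 ℚ./ 1) :* (e₁₂ :* e₂₁)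
              w = λ x y → x :* (e₂₁ :+ e₂₁) :- ((e₁₁ :- e₂₂) :- s) :* y in
          w (e₁₁ :* x :+ e₁₂ :* y) (e₂₁ :* x :+ e₂₂ :* y)
          := (con ℚ.½ :* ((e₁₁ :+ e₂₂) :+ s)) :* w x y :+ con ℚ.½ :* ((Δ :- s :* s) :* y))
          refl e₁₁ e₁₂ e₂₁ e₂₂ s x y)
        (trans (+-congˡ (*-congˡ (*-congʳ (+-congʳ (sym Δ≈))))) (drop (λ₊ * w₊ x y) y))

      w₋-act : ∀ x y → w₋ (actˣ x y) (actʸ x y) ≈ λ₋ * w₋ x y
      w₋-act x y = trans
        (solve 7 (λ e₁₁ e₁₂ e₂₁ e₂₂ s x y →
          let b = e₂₂ :- e₁₁ ; Δ = b :* b :+ con (+ 4 ℚ./ 1) :* (e₁₂ :* e₂₁)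
              w = λ x y → x :* (e₂₁ :+ e₂₁) :- ((e₁₁ :- e₂₂) :+ s) :* y in
          w (e₁₁ :* x :+ e₁₂ :* y) (e₂₁ :* x :+ e₂₂ :* y)
          := (con ℚ.½ :* ((e₁₁ :+ e₂₂) :- s)) :* w x y :+ con ℚ.½ :* ((Δ :- s :* s) :* y))
          refl e₁₁ e₁₂ e₂₁ e₂₂ s x y)
        (trans (+-congˡ (*-congˡ (*-congʳ (+-congʳ (sym Δ≈))))) (drop (λ₋ * w₋ x y) y))

      λ₊λ₋≈det : λ₊ * λ₋ ≈ e₁₁ * e₂₂ - e₁₂ * e₂₁
      λ₊λ₋≈det = trans
        (solve 2 (λ t s → (con ℚ.½ :* (t :+ s)) :* (con ℚ.½ :* (t :- s))
          := con (+ 1 ℚ./ 4) :* (t :* t :- s :* s)) refl t s)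
        (trans (*-congˡ (+-congˡ (-‿cong (trans s²≈Δ Δ≈))))
          (solve 4 (λ e₁₁ e₁₂ e₂₁ e₂₂ →
            con (+ 1 ℚ./ 4) :* ((e₁₁ :+ e₂₂) :* (e₁₁ :+ e₂₂)
              :- ((e₂₂ :- e₁₁) :* (e₂₂ :- e₁₁) :+ con (+ 4 ℚ./ 1) :* (e₁₂ :* e₂₁)))
            := e₁₁ :* e₂₂ :- e₁₂ :* e₂₁) refl e₁₁ e₁₂ e₂₁ e₂₂))

      w₊w₋≈ : ∀ x y → w₊ x y * w₋ x y ≈ Φ x y
      w₊w₋≈ x y = trans
        (solve 6 (λ e₁₁ e₂₁ e₂₂ s x y →
          let g = (e₂₁ :+ e₂₁) :* x :+ (e₂₂ :- e₁₁) :* y ; e = e₂₁ :+ e₂₁ in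
          (x :* e :- ((e₁₁ :- e₂₂) :- s) :* y) :* (x :* e :- ((e₁₁ :- e₂₂) :+ s) :* y)
          := g :* g :- (s :* s) :* (y :* y)) refl e₁₁ e₂₁ e₂₂ s x y)
        (+-congˡ (-‿cong (*-congʳ s²≈Δ)))

      module Attraction (det²≈1 : (e₁₁ * e₂₂ - e₁₂ * e₂₁) * (e₁₁ * e₂₂ - e₁₂ * e₂₁) ≈ 1#)
                        (0<ts : Pos (t * s)) (0<e₂₁² : Pos (e₂₁ * e₂₁)) where

        private
          -- `M` = λ₊⁴ equals the ratio λ₊² / λ₋², because λ₊² λ₋² = det² = 1.
          Q Q⁻¹ M : Carrier
          Q   = λ₊ * λ₊
          Q⁻¹ = λ₋ * λ₋
          M   = Q * Q

          QQ⁻¹≈1 : Q * Q⁻¹ ≈ 1#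
          QQ⁻¹≈1 = trans
            (solve 2 (λ a b → (a :* a) :* (b :* b) := (a :* b) :* (a :* b)) refl λ₊ λ₋)
            (trans (*-cong λ₊λ₋≈det λ₊λ₋≈det) det²≈1)

          0<1 : Pos 1#
          0<1 = pos-resp 1#-homo (pos-ι (ℚ.positive⁻¹ 1ℚ))

          0<Q : Pos Q
          0<Q = pos-cancel² λ₋ (pos-resp (sym QQ⁻¹≈1) 0<1)

          -- The difference λ₊² - λ₋² = t s, multiplied by λ₊², becomes λ₊⁴ - 1.
          0<M-1 : Pos (M - 1#)
          0<M-1 = pos-resp
            (trans (solve 2 (λ t s →
                let a = con ℚ.½ :* (t :+ s) ; b = con ℚ.½ :* (t :- s) in
                (a :* a) :* (t :* s) := (a :* a) :* (a :* a) :- (a :* a) :* (b :* b)) refl t s)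
              (+-congˡ (-‿cong QQ⁻¹≈1)))
            (pos-* 0<Q 0<ts)

        eigen-norm²-pos : Pos (norm² eigen-x eigen-y)
        eigen-norm²-pos = pos-resp
          (solve 2 (λ e a → con (+ 4 ℚ./ 1) :* (e :* e) :+ a :* a := a :* a :+ (e :+ e) :* (e :+ e))
            refl e₂₁ eigen-x)
          (pos-+² eigen-x (pos-* (pos-lit 4) 0<e₂₁²))

        private
          conj-norm²-pos : Pos (norm² conj-x eigen-y)
          conj-norm²-pos = pos-resp
            (solve 2 (λ e a → con (+ 4 ℚ./ 1) :* (e :* e) :+ a :* a := a :* a :+ (e :+ e) :* (e :+ e))
              refl e₂₁ conj-x)
            (pos-+² conj-x (pos-* (pos-lit 4) 0<e₂₁²))

        module _ (x y : ℕ → Carrier)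
                 (x-step : ∀ j → x (suc j) ≈ actˣ (x j) (y j))
                 (y-step : ∀ j → y (suc j) ≈ actʸ (x j) (y j))
                 (0<w₊w₋² : Pos ((w₊ (x 0) (y 0) * w₋ (x 0) (y 0)) * (w₊ (x 0) (y 0) * w₋ (x 0) (y 0))))
                 where

          private
            D W : ℕ → Carrier
            D j = w₊ (x j) (y j) * w₊ (x j) (y j)
            W j = w₋ (x j) (y j) * w₋ (x j) (y j)

            det-cong : ∀ {a a′ b b′} c d → a ≈ a′ → b ≈ b′ → det a b c d ≈ det a′ b′ c d
            det-cong c d a≈ b≈ = +-cong (*-congʳ a≈) (-‿cong (*-congˡ b≈))

            square-* : ∀ a b → (a * b) * (a * b) ≈ (a * a) * (b * b)
            square-* = solve 2 (λ a b → (a :* b) :* (a :* b) := (a :* a) :* (b :* b)) refl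

            D-step : ∀ j → D (suc j) ≈ Q * D j
            D-step j = trans (*-cong h h) (square-* λ₊ (w₊ (x j) (y j)))
              where h = trans (det-cong _ _ (x-step j) (y-step j)) (w₊-act (x j) (y j))

            W-step : ∀ j → W (suc j) ≈ Q⁻¹ * W j
            W-step j = trans (*-cong h h) (square-* λ₋ (w₋ (x j) (y j)))
              where h = trans (det-cong _ _ (x-step j) (y-step j)) (w₋-act (x j) (y j))

            0<D : ∀ j → Pos (D j)
            0<D zero    = pos-cancel² (w₋ (x 0) (y 0)) (pos-resp (square-* _ _) 0<w₊w₋²)
            0<D (suc j) = pos-resp (sym (D-step j)) (pos-* 0<Q (0<D j))

            0<M^ : ∀ j → Pos (j ×* M)
            0<M^ zero    = 0<1
            0<M^ (suc j) = pos-* (pos-* 0<Q 0<Q) (0<M^ j)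

            -- The quotient `W j / D j` shrinks by the factor `M` at each step; the denominators are
            -- cleared.
            W-decay : ∀ j → W j * (D 0 * (j ×* M)) ≈ W 0 * D j
            W-decay zero    = *-congˡ (*-identityʳ (D 0))
            W-decay (suc j) = begin
              W (suc j) * (D 0 * (M * (j ×* M)))
                ≈⟨ *-congʳ (W-step j) ⟩
              (Q⁻¹ * W j) * (D 0 * (M * (j ×* M)))
                ≈⟨ solve 5 (λ q q⁻¹ w d p →
                     (q⁻¹ :* w) :* (d :* ((q :* q) :* p)) := (q :* q⁻¹) :* (q :* (w :* (d :* p))))
                     refl Q Q⁻¹ (W j) (D 0) (j ×* M) ⟩
              (Q * Q⁻¹) * (Q * (W j * (D 0 * (j ×* M))))
                ≈⟨ *-cong QQ⁻¹≈1 (*-congˡ (W-decay j)) ⟩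
              1# * (Q * (W 0 * D j))
                ≈⟨ *-identityˡ _ ⟩
              Q * (W 0 * D j)
                ≈⟨ solve 3 (λ q w d → q :* (w :* d) := w :* (q :* d)) refl Q (W 0) (D j) ⟩
              W 0 * (Q * D j)
                ≈⟨ *-congˡ (D-step j) ⟨
              W 0 * D (suc j) ∎

          -- Lagrange's identity with the repelling eigenvector gives |v|² n′ ≥ D j. So it suffices
          -- that e n D j exceeds n′ W j, and by `W-decay` this amounts to e n D 0 Mʲ > n′ W 0, true
          -- for large j.
          attraction : ∀ {e} → Pos e → ∃[ j₀ ] ∀ j → j₀ ℕ.≤ j →
            Pos (e * (norm² (x j) (y j) * norm² eigen-x eigen-y) - W j)
          attraction {e} 0<e =
            let j₀ , large = growth (W 0 * n′) 0<M-1 (pos-* (pos-* 0<e eigen-norm²-pos) (0<D 0))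
            in j₀ , λ j j₀≤j → pos-cancel conj-norm²-pos (pos-resp
              (solve 7 (λ e n W x y a b →
                 let w = x :* b :- a :* y ; d = x :* a :+ y :* b in
                 ((e :* n) :* (w :* w) :- (a :* a :+ b :* b) :* W) :+ (e :* n) :* (d :* d)
                 := (e :* ((x :* x :+ y :* y) :* n) :- W) :* (a :* a :+ b :* b))
                 refl e n (W j) (x j) (y j) conj-x eigen-y)
              (pos-+*² (x j * conj-x + y j * eigen-y)
                (pos-cancel (pos-* (0<D 0) (0<M^ j)) (pos-resp
                  (trans (solve 6 (λ m a D₀ n′ W₀ Dⱼ →
                      (m :* (a :* D₀) :- W₀ :* n′) :* Dⱼ := (a :* Dⱼ) :* (D₀ :* m) :- n′ :* (W₀ :* Dⱼ))
                      refl (j ×* M) (e * n) (D 0) n′ (W 0) (D j))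
                    (trans (+-congˡ (-‿cong (*-congˡ (sym (W-decay j)))))
                      (solve 5 (λ a Dⱼ n′ Wⱼ c → (a :* Dⱼ) :* c :- n′ :* (Wⱼ :* c)
                        := (a :* Dⱼ :- n′ :* Wⱼ) :* c)
                        refl (e * n) (D j) n′ (W j) (D 0 * (j ×* M)))))
                  (pos-* (large j j₀≤j) (0<D j))))
                (pos-* 0<e eigen-norm²-pos)))
            where
            n n′ : Carrier
            n  = norm² eigen-x eigen-y
            n′ = norm² conj-x eigen-y

    -- The eigenvector is produced before the orbit, so that the orbits of all residue classes share
    -- one limit.
    attractor : (e₁₁ * e₂₂ - e₁₂ * e₂₁) * (e₁₁ * e₂₂ - e₁₂ * e₂₁) ≈ 1# →
      Pos Δ → Pos (t * t) → Pos (e₂₁ * e₂₁) →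
      ∃[ px ] ∃[ py ] Pos (norm² px py) ×
        (∀ (x y : ℕ → Carrier) → (∀ j → x (suc j) ≈ actˣ (x j) (y j)) → (∀ j → y (suc j) ≈ actʸ (x j) (y j)) →
          Pos (Φ (x 0) (y 0) * Φ (x 0) (y 0)) → ∀ {e} → Pos e → ∃[ j₀ ] ∀ j → j₀ ℕ.≤ j →
          Pos (e * (norm² (x j) (y j) * norm² px py)
            - det (x j) (y j) px py * det (x j) (y j) px py))
    attractor det²≈1 0<Δ 0<t² 0<e₂₁² =
      let s , s²≈Δ , 0<ts = root
          open Eigen s s²≈Δ
          open Attraction det²≈1 0<ts 0<e₂₁²
      in eigen-x , eigen-y , eigen-norm²-pos , λ x y x-step y-step 0<Φ² →
           attraction x y x-step y-step
             (pos-resp (sym (*-cong (w₊w₋≈ (x 0) (y 0)) (w₊w₋≈ (x 0) (y 0)))) 0<Φ²)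
      where
      -- Of the two roots of Δ, the one with the sign of the trace makes `λ₊` dominant.
      root : ∃[ s ] s * s ≈ Δ × Pos (t * s)
      root with square-root 0<Δ
      ... | s , s²≈Δ with sign (pos-resp
              (trans (*-congˡ (sym s²≈Δ))
                (solve 2 (λ t s → (t :* t) :* (s :* s) := (t :* s) :* (t :* s)) refl t s))
              (pos-* 0<t² 0<Δ))
      ... | inj₁ 0<ts = s , s²≈Δ , 0<ts
      ... | inj₂ ts<0 = - s
        , trans (solve 1 (λ s → :- s :* :- s := s :* s) refl s) s²≈Δ
        , pos-resp (solve 2 (λ t s → :- (t :* s) := t :* :- s) refl t s) ts<0

-- Products of the matrices D(α), and convergents

module MatrixProperties {c ℓ} (R : CommutativeRing c ℓ) (ι : ℚ → CommutativeRing.Carrier R)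
  (ι-isRingHomomorphism :
    IsRingHomomorphism ℚ.+-*-rawRing (CommutativeRing.rawRing R) ι) where

  open CommutativeRing R
  open ℚ-AlgebraSolver R ι ι-isRingHomomorphism
  open Matrices R public

  M₂-setoid : Setoid c ℓ
  M₂-setoid = record
    { Carrier = M₂ ; _≈_ = _≈ᴹ_
    ; isEquivalence = record
      { refl  = eq refl refl refl refl
      ; sym   = λ (eq p q r s) → eq (sym p) (sym q) (sym r) (sym s)
      ; trans = λ (eq p q r s) (eq p′ q′ r′ s′) →
          eq (trans p p′) (trans q q′) (trans r r′) (trans s s′) } }

  open Setoid M₂-setoid public using ()
    renaming (refl to ≈ᴹ-refl; sym to ≈ᴹ-sym; trans to ≈ᴹ-trans)
  open import Relation.Binary.Reasoning.Setoid M₂-setoid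

  *ᴹ-cong : ∀ {A A′ B B′} → A ≈ᴹ A′ → B ≈ᴹ B′ → A *ᴹ B ≈ᴹ A′ *ᴹ B′
  *ᴹ-cong (eq p q r s) (eq p′ q′ r′ s′) = eq
    (+-cong (*-cong p p′) (*-cong q r′)) (+-cong (*-cong p q′) (*-cong q s′))
    (+-cong (*-cong r p′) (*-cong s r′)) (+-cong (*-cong r q′) (*-cong s s′))

  *ᴹ-assoc : ∀ A B C → (A *ᴹ B) *ᴹ C ≈ᴹ A *ᴹ (B *ᴹ C)
  *ᴹ-assoc A B C = eq (entry _ _ _ _ _ _ _ _) (entry _ _ _ _ _ _ _ _)
                      (entry _ _ _ _ _ _ _ _) (entry _ _ _ _ _ _ _ _)
    where
    entry : ∀ a b p q r s x y →
      (a * p + b * r) * x + (a * q + b * s) * y ≈ a * (p * x + q * y) + b * (r * x + s * y)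
    entry = solve 8 (λ a b p q r s x y →
      (a :* p :+ b :* r) :* x :+ (a :* q :+ b :* s) :* y
      := a :* (p :* x :+ q :* y) :+ b :* (r :* x :+ s :* y)) refl

  private
    1-0 : ∀ x y → 1# * x + 0# * y ≈ x
    1-0 x y = trans (+-cong (*-identityˡ x) (zeroˡ y)) (+-identityʳ x)

    0-1 : ∀ x y → 0# * x + 1# * y ≈ y
    0-1 x y = trans (+-cong (zeroˡ x) (*-identityˡ y)) (+-identityˡ y)

    1-0′ : ∀ x y → x * 1# + y * 0# ≈ x
    1-0′ x y = trans (+-cong (*-identityʳ x) (zeroʳ y)) (+-identityʳ x)

    0-1′ : ∀ x y → x * 0# + y * 1# ≈ y
    0-1′ x y = trans (+-cong (zeroʳ x) (*-identityʳ y)) (+-identityˡ y)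

  *ᴹ-identityˡ : ∀ A → Iᴹ *ᴹ A ≈ᴹ A
  *ᴹ-identityˡ A = eq (1-0 _ _) (1-0 _ _) (0-1 _ _) (0-1 _ _)

  *ᴹ-identityʳ : ∀ A → A *ᴹ Iᴹ ≈ᴹ A
  *ᴹ-identityʳ A = eq (1-0′ _ _) (0-1′ _ _) (1-0′ _ _) (0-1′ _ _)

  D-inverseˡ : ∀ α → D⁻¹ α *ᴹ D α ≈ᴹ Iᴹ
  D-inverseˡ α = eq (0-1 α 1#) (0-1 1# 0#)
    (trans (+-cong (*-identityˡ α) (*-identityʳ (- α))) (-‿inverseʳ α))
    (trans (+-cong (*-identityˡ 1#) (zeroʳ (- α))) (+-identityʳ 1#))

  D-cong : ∀ {α β} → α ≈ β → D α ≈ᴹ D β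
  D-cong α≈β = eq α≈β refl refl refl

  ΠD-inverseˡ : ∀ αs → ΠD⁻¹ αs *ᴹ ΠD αs ≈ᴹ Iᴹ
  ΠD-inverseˡ []       = *ᴹ-identityˡ Iᴹ
  ΠD-inverseˡ (α ∷ αs) = begin
    (A⁻¹ *ᴹ D⁻¹ α) *ᴹ (D α *ᴹ A)    ≈⟨ *ᴹ-assoc A⁻¹ (D⁻¹ α) (D α *ᴹ A) ⟩
    A⁻¹ *ᴹ (D⁻¹ α *ᴹ (D α *ᴹ A))    ≈⟨ *ᴹ-cong ≈ᴹ-refl (*ᴹ-assoc (D⁻¹ α) (D α) A) ⟨
    A⁻¹ *ᴹ ((D⁻¹ α *ᴹ D α) *ᴹ A)    ≈⟨ *ᴹ-cong ≈ᴹ-refl (*ᴹ-cong (D-inverseˡ α) ≈ᴹ-refl) ⟩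
    A⁻¹ *ᴹ (Iᴹ *ᴹ A)                ≈⟨ *ᴹ-cong ≈ᴹ-refl (*ᴹ-identityˡ A) ⟩
    A⁻¹ *ᴹ A                        ≈⟨ ΠD-inverseˡ αs ⟩
    Iᴹ ∎
    where
    A A⁻¹ : M₂
    A   = ΠD αs
    A⁻¹ = ΠD⁻¹ αs

  ΠD-+ : ∀ (a : ℕ → Carrier) m n →
    ΠD (applyUpTo a (m ℕ.+ n)) ≈ᴹ ΠD (applyUpTo a m) *ᴹ ΠD (applyUpTo (λ i → a (m ℕ.+ i)) n)
  ΠD-+ a zero    n = ≈ᴹ-sym (*ᴹ-identityˡ _)
  ΠD-+ a (suc m) n = ≈ᴹ-trans (*ᴹ-cong ≈ᴹ-refl (ΠD-+ (λ i → a (suc i)) m n))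
    (≈ᴹ-sym (*ᴹ-assoc (D (a 0)) _ _))

  ΠD-suc : ∀ (a : ℕ → Carrier) n →
    ΠD (applyUpTo a (suc n)) ≈ᴹ ΠD (applyUpTo a n) *ᴹ D (a n)
  ΠD-suc a zero    = ≈ᴹ-trans (*ᴹ-identityʳ (D (a 0))) (≈ᴹ-sym (*ᴹ-identityˡ (D (a 0))))
  ΠD-suc a (suc n) = ≈ᴹ-trans (*ᴹ-cong ≈ᴹ-refl (ΠD-suc (λ i → a (suc i)) n))
    (≈ᴹ-sym (*ᴹ-assoc (D (a 0)) _ (D (a (suc n)))))

  -- The columns are consecutive convergents. At least two factors are taken so that the index -1
  -- does not occur.
  ΠD-convergents : ∀ (a : ℕ → Carrier) n → ΠD (applyUpTo a (2 ℕ.+ n)) ≈ᴹ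
    mat (recurrence a 1# (a 0) (suc n)) (recurrence a 1# (a 0) n)
        (recurrence a 0# 1# (suc n))    (recurrence a 0# 1# n)
  ΠD-convergents a zero = ≈ᴹ-trans (ΠD-suc a 1)
    (≈ᴹ-trans (*ᴹ-cong (*ᴹ-identityʳ (D (a 0))) ≈ᴹ-refl) (eq
      (+-cong (*-comm (a 0) (a 1)) (*-identityˡ 1#))
      (1-0′ (a 0) 1#)
      (+-cong (*-comm 1# (a 1)) (zeroˡ 1#))
      (1-0′ 1# 0#)))
  ΠD-convergents a (suc n) = ≈ᴹ-trans (ΠD-suc a (2 ℕ.+ n))
    (≈ᴹ-trans (*ᴹ-cong (ΠD-convergents a n) ≈ᴹ-refl) (eq
      (+-cong (*-comm _ (a (2 ℕ.+ n))) (*-identityʳ _))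
      (1-0′ _ _)
      (+-cong (*-comm _ (a (2 ℕ.+ n))) (*-identityʳ _))
      (1-0′ _ _)))

  ΠD-convergent : ∀ (a : ℕ → Carrier) n →
    e₁₁ (ΠD (applyUpTo a (suc n))) ≈ recurrence a 1# (a 0) n ×
    e₂₁ (ΠD (applyUpTo a (suc n))) ≈ recurrence a 0# 1# n
  ΠD-convergent a zero    = 1-0′ (a 0) 1# , 1-0′ 1# 0#
  ΠD-convergent a (suc n) = let eq p _ r _ = ΠD-convergents a n in p , r

  detᴹ : M₂ → Carrier
  detᴹ (mat a b c d) = a * d - b * c

  -- Each D(α) has determinant -1; squaring spares following the parity of the number of factors.
  Unimodular : M₂ → Set ℓ
  Unimodular A = detᴹ A * detᴹ A ≈ 1#

  unimodular-* : ∀ A B → Unimodular A → Unimodular B → Unimodular (A *ᴹ B)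
  unimodular-* A B hA hB = trans
    (solve 8 (λ a b c d a′ b′ c′ d′ →
      let δ = (a :* a′ :+ b :* c′) :* (c :* b′ :+ d :* d′) :- (a :* b′ :+ b :* d′) :* (c :* a′ :+ d :* c′)
          δ₁ = a :* d :- b :* c ; δ₂ = a′ :* d′ :- b′ :* c′ in
      δ :* δ := (δ₁ :* δ₁) :* (δ₂ :* δ₂)) refl
      (e₁₁ A) (e₁₂ A) (e₂₁ A) (e₂₂ A) (e₁₁ B) (e₁₂ B) (e₂₁ B) (e₂₂ B))
    (trans (*-cong hA hB) (*-identityˡ 1#))

  private
    square-1 : ∀ {x} → x ≈ 0# → (x - 1# * 1#) * (x - 1# * 1#) ≈ 1#
    square-1 {x} x≈0 = trans (*-cong h h)
      (trans (solve 1 (λ u → :- (u :* u) :* :- (u :* u) := (u :* u) :* (u :* u)) refl 1#)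
        (trans (*-cong (*-identityˡ 1#) (*-identityˡ 1#)) (*-identityˡ 1#)))
      where
      h : x - 1# * 1# ≈ - (1# * 1#)
      h = trans (+-congʳ x≈0) (+-identityˡ _)

  unimodular-ΠD : ∀ αs → Unimodular (ΠD αs)
  unimodular-ΠD [] = trans (*-cong h h) (*-identityˡ 1#)
    where
    h : 1# * 1# - 0# * 0# ≈ 1#
    h = trans (+-cong (*-identityˡ 1#) (-‿cong (zeroˡ 0#))) (-‿inverse-0 1#)
      where
      -‿inverse-0 : ∀ x → x - 0# ≈ x
      -‿inverse-0 x = trans (+-congˡ (trans (sym (+-identityˡ (- 0#))) (-‿inverseʳ 0#))) (+-identityʳ x)
  unimodular-ΠD (α ∷ αs) = unimodular-* (D α) (ΠD αs) (square-1 (zeroʳ α)) (unimodular-ΠD αs)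

  unimodular-ΠD⁻¹ : ∀ αs → Unimodular (ΠD⁻¹ αs)
  unimodular-ΠD⁻¹ []       = unimodular-ΠD []
  unimodular-ΠD⁻¹ (α ∷ αs) =
    unimodular-* (ΠD⁻¹ αs) (D⁻¹ α) (unimodular-ΠD⁻¹ αs) (square-1 (zeroˡ (- α)))

-- Decidable equality and the norm form in the quadratic field

module RealQuadraticFieldProperties {c ℓ} (K : RealQuadraticField c ℓ) where

  open RealQuadraticField K
  open ℚ-AlgebraSolver commutativeRing ι ι-isRingHomomorphism public
  open import Relation.Binary.Reasoning.Setoid setoid
  private
    module ιᴴ = IsRingHomomorphism ι-isRingHomomorphism

  1≉0 : ¬ 1# ≈ 0#
  1≉0 1≈0 with proj₁ (independent 1ℚ 0ℚ (trivial _))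
    where
    trivial : ∀ x → x ≈ 0#
    trivial x = trans (sym (*-identityˡ x)) (trans (*-congʳ 1≈0) (zeroˡ x))
  ... | ()

  -- By independence an element vanishes exactly when both of its rational coordinates do.
  _≈0? : ∀ x → Dec (x ≈ 0#)
  x ≈0? with spanning x
  ... | p , q , x≈ with p ℚ.≟ 0ℚ | q ℚ.≟ 0ℚ
  ... | yes ≡.refl | yes ≡.refl = yes (trans x≈
        (trans (+-cong (0* b₁) (0* b₂)) (+-identityˡ 0#)))
    where
    0* : ∀ b → ι 0ℚ * b ≈ 0#
    0* b = trans (*-congʳ ιᴴ.0#-homo) (zeroˡ b)
  ... | no p≢0 | _ = no λ x≈0 → p≢0 (proj₁ (independent p q (trans (sym x≈) x≈0)))
  ... | _ | no q≢0 = no λ x≈0 → q≢0 (proj₂ (independent p q (trans (sym x≈) x≈0)))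

  no-zero-divisors : ∀ {x y} → ¬ x ≈ 0# → x * y ≈ 0# → y ≈ 0#
  no-zero-divisors {x} {y} x≉0 xy≈0 = let x⁻¹ , xx⁻¹≈1 = inverse x x≉0 in begin
    y              ≈⟨ *-identityˡ y ⟨
    1# * y         ≈⟨ *-congʳ xx⁻¹≈1 ⟨
    x * x⁻¹ * y    ≈⟨ solve 3 (λ x i y → x :* i :* y := i :* (x :* y)) refl x x⁻¹ y ⟩
    x⁻¹ * (x * y)  ≈⟨ *-congˡ xy≈0 ⟩
    x⁻¹ * 0#       ≈⟨ zeroʳ x⁻¹ ⟩
    0#             ∎

  square≈0 : ∀ {x} → x * x ≈ 0# → x ≈ 0#
  square≈0 {x} x²≈0 with x ≈0?
  ... | yes x≈0 = x≈0
  ... | no  x≉0 = no-zero-divisors x≉0 x²≈0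

  difference≈0 : ∀ {x y} → x - y ≈ 0# → x ≈ y
  difference≈0 {x} {y} h =
    trans (solve 2 (λ x y → x := (x :- y) :+ y) refl x y) (trans (+-congʳ h) (+-identityˡ y))

  -- A zero of the norm form g² − Δ y² would make Δ = (g / y)².
  norm-form-anisotropic : ∀ {Δ g y} → ¬ IsSquare Δ → g * g - Δ * (y * y) ≈ 0# → g ≈ 0# × y ≈ 0#
  norm-form-anisotropic {Δ} {g} {y} ¬sq h with y ≈0?
  ... | yes y≈0 = square≈0 (trans (difference≈0 h)
        (trans (*-congˡ (trans (*-congʳ y≈0) (zeroˡ y))) (zeroʳ Δ))) , y≈0
  ... | no y≉0 = let y⁻¹ , yy⁻¹≈1 = inverse y y≉0 in contradiction (g * y⁻¹ , (begin
    (g * y⁻¹) * (g * y⁻¹)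
      ≈⟨ solve 2 (λ g i → (g :* i) :* (g :* i) := (g :* g) :* (i :* i)) refl g y⁻¹ ⟩
    (g * g) * (y⁻¹ * y⁻¹)
      ≈⟨ *-congʳ (difference≈0 h) ⟩
    (Δ * (y * y)) * (y⁻¹ * y⁻¹)
      ≈⟨ solve 3 (λ Δ y i → (Δ :* (y :* y)) :* (i :* i) := Δ :* ((y :* i) :* (y :* i))) refl Δ y y⁻¹ ⟩
    Δ * ((y * y⁻¹) * (y * y⁻¹))
      ≈⟨ *-congˡ (trans (*-cong yy⁻¹≈1 yy⁻¹≈1) (*-identityˡ 1#)) ⟩
    Δ * 1#
      ≈⟨ *-identityʳ Δ ⟩
    Δ ∎)) ¬sq

  double≈0 : ∀ {x} → x + x ≈ 0# → x ≈ 0#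
  double≈0 {x} h = trans (solve 1 (λ x → x := con ℚ.½ :* (x :+ x)) refl x)
    (trans (*-congˡ h) (zeroʳ (ι ℚ.½)))

-- The action of the period matrix on convergents

module PCFProperties {c ℓ} {K : RealQuadraticField c ℓ} (P : PeriodicCF K) where

  open RealQuadraticField K
  open RealQuadraticFieldProperties K public
  open MatrixProperties commutativeRing ι ι-isRingHomomorphism
  open PeriodicCF P
  open PCF P
  open import Relation.Binary.Reasoning.Setoid M₂-setoid

  private
    V : ℕ → M₂
    V n = ΠD (applyUpTo a n)

  -- At the end of the preperiod, (B M B⁻¹) B = B M. Each further factor on the right is the same on
  -- both sides by periodicity. As `V n` has `n` factors, the convergent of index `n` stands in
  -- `V (suc n)`.
  E-shift : ∀ d → V (suc N ℕ.+ d ℕ.+ k) ≈ᴹ E *ᴹ V (suc N ℕ.+ d)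
  E-shift zero = ≡.subst (λ n → V (n ℕ.+ k) ≈ᴹ E *ᴹ V n) (≡.sym (ℕ.+-identityʳ (suc N))) (begin
    V (suc N ℕ.+ k)          ≈⟨ ΠD-+ a (suc N) k ⟩
    BM                       ≈⟨ *ᴹ-identityʳ BM ⟨
    BM *ᴹ Iᴹ                 ≈⟨ *ᴹ-cong ≈ᴹ-refl (ΠD-inverseˡ preperiod) ⟨
    BM *ᴹ (B⁻¹ *ᴹ V (suc N)) ≈⟨ *ᴹ-assoc BM B⁻¹ (V (suc N)) ⟨
    E *ᴹ V (suc N)           ∎)
    where
    BM B⁻¹ : M₂
    BM  = ΠD preperiod *ᴹ ΠD period
    B⁻¹ = ΠD⁻¹ preperiod
  E-shift (suc d) =
    ≡.subst (λ n → V (n ℕ.+ k) ≈ᴹ E *ᴹ V n) (≡.sym (ℕ.+-suc (suc N) d)) (begin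
      V (suc m ℕ.+ k)            ≈⟨ ΠD-suc a (m ℕ.+ k) ⟩
      V (m ℕ.+ k) *ᴹ D (a (m ℕ.+ k))
        ≈⟨ *ᴹ-cong (E-shift d) (D-cong (periodic m (ℕ.m≤m+n (suc N) d))) ⟩
      (E *ᴹ V m) *ᴹ D (a m)      ≈⟨ *ᴹ-assoc E (V m) (D (a m)) ⟩
      E *ᴹ (V m *ᴹ D (a m))      ≈⟨ *ᴹ-cong ≈ᴹ-refl (ΠD-suc a m) ⟨
      E *ᴹ V (suc m)             ∎)
    where
    m : ℕ
    m = suc N ℕ.+ d

  convergent-shift : ∀ n → N ℕ.≤ n →
    numerator (n ℕ.+ k) ≈ e₁₁ E * numerator n + e₁₂ E * denominator n ×
    denominator (n ℕ.+ k) ≈ e₂₁ E * numerator n + e₂₂ E * denominator n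
  convergent-shift n N≤n =
    let eq p _ r _ = ≡.subst (λ m → V (m ℕ.+ k) ≈ᴹ E *ᴹ V m) (≡.cong suc (ℕ.m+[n∸m]≡n N≤n)) (E-shift (n ℕ.∸ N))
        num′ , den′ = ΠD-convergent a (n ℕ.+ k)
        num , den = ΠD-convergent a n
    in trans (sym num′) (trans p (+-cong (*-congˡ num) (*-congˡ den)))
     , trans (sym den′) (trans r (+-cong (*-congˡ num) (*-congˡ den)))

  -- A left-invertible matrix has no zero column: the upper left entry of the inverse times the
  -- matrix would be 0 instead of 1.
  convergent-nonzero : ∀ n → numerator n ≈ 0# → ¬ denominator n ≈ 0#
  convergent-nonzero n num≈0 den≈0 =
    let eq p _ _ _ = ΠD-inverseˡ (applyUpTo a (suc n))
        num , den = ΠD-convergent a n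
    in 1≉0 (trans (sym p) (trans
         (+-cong (trans (*-congˡ (trans num num≈0)) (zeroʳ _)) (trans (*-congˡ (trans den den≈0)) (zeroʳ _)))
         (+-identityˡ 0#)))

  E-unimodular : Unimodular E
  E-unimodular = unimodular-* _ (ΠD⁻¹ preperiod)
    (unimodular-* (ΠD preperiod) (ΠD period) (unimodular-ΠD preperiod) (unimodular-ΠD period))
    (unimodular-ΠD⁻¹ preperiod)

  Δ≈ : Δ ≈ (e₂₂ E - e₁₁ E) * (e₂₂ E - e₁₁ E) + ι (+ 4 ℚ./ 1) * (e₁₂ E * e₂₁ E)
  Δ≈ = +-congˡ (4·≈4* (e₁₂ E * e₂₁ E))

  Φ : ℕ → Carrier
  Φ n = let g = (e₂₁ E + e₂₁ E) * numerator n + (e₂₂ E - e₁₁ E) * denominator n in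
    g * g - Δ * (denominator n * denominator n)

  module _ (¬sq : ¬ IsSquare Δ) where

    -- Otherwise Δ is the square of e₂₂ - e₁₁.
    e₂₁≉0 : ¬ e₂₁ E ≈ 0#
    e₂₁≉0 h = ¬sq (e₂₂ E - e₁₁ E , sym (trans Δ≈ (trans
      (+-congˡ (trans (*-congˡ (trans (*-congˡ h) (zeroʳ (e₁₂ E)))) (zeroʳ _))) (+-identityʳ _))))

    Φ≉0 : ∀ n → ¬ Φ n ≈ 0#
    Φ≉0 n h =
      let g≈0 , den≈0 = norm-form-anisotropic ¬sq h
          2e₂₁·num≈0 = trans
            (sym (trans (+-congˡ (trans (*-congˡ den≈0) (zeroʳ _))) (+-identityʳ _))) g≈0
      in convergent-nonzero n
           (no-zero-divisors (λ 2e₂₁≈0 → e₂₁≉0 (double≈0 2e₂₁≈0)) 2e₂₁·num≈0) den≈0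

    -- With trace T and determinant d, Δ = T² - 4 d and d² = 1 give (Δ + 4)(Δ - 4) = T⁴ - 8 T² d,
    -- which vanishes with T. The second factor is nonzero because 4 is a square.
    trace≈0⇒Δ≈-4 : e₁₁ E + e₂₂ E ≈ 0# → Δ + ι (+ 2 ℚ./ 1) * ι (+ 2 ℚ./ 1) ≈ 0#
    trace≈0⇒Δ≈-4 t≈0 with (Δ + 2ι * 2ι) ≈0?
      where
      2ι : Carrier
      2ι = ι (+ 2 ℚ./ 1)
    ... | yes h = h
    ... | no h = contradiction (2ι , sym (difference≈0 (no-zero-divisors h product≈0))) ¬sq
      where
      2ι : Carrier
      2ι = ι (+ 2 ℚ./ 1)
      product≈0 : (Δ + 2ι * 2ι) * (Δ - 2ι * 2ι) ≈ 0#
      product≈0 = trans (*-cong (+-congʳ Δ≈) (+-congʳ Δ≈)) (trans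
        (solve 4 (λ a b c e →
          let four = con (+ 4 ℚ./ 1) ; two = con (+ 2 ℚ./ 1) ; 16c = con (+ 16 ℚ./ 1)
              Δ = (e :- a) :* (e :- a) :+ four :* (b :* c)
              d = a :* e :- b :* c ; T = a :+ e in
          (Δ :+ two :* two) :* (Δ :- two :* two)
          := T :* (T :* (T :* T) :- con (+ 8 ℚ./ 1) :* (T :* d)) :+ 16c :* (d :* d :- con 1ℚ))
          refl (e₁₁ E) (e₁₂ E) (e₂₁ E) (e₂₂ E))
        (trans (+-cong (trans (*-congʳ t≈0) (zeroˡ _))
          (trans (*-congˡ (trans (+-cong E-unimodular (-‿cong ι1≈1)) (-‿inverseʳ 1#))) (zeroʳ _)))
          (+-identityˡ 0#)))
        where
        ι1≈1 : ι 1ℚ ≈ 1#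
        ι1≈1 = IsRingHomomorphism.1#-homo ι-isRingHomomorphism

-- Transport along the real embedding

module Embedded {c ℓ} {K : RealQuadraticField c ℓ} (P : PeriodicCF K) (A : OrderedAlgebra)
  (σ : RealQuadraticField.Carrier K → OrderedAlgebra.Carrier A)
  (σ-isRingHomomorphism :
    IsRingHomomorphism (RealQuadraticField.rawRing K) (OrderedAlgebra.rawRing A) σ) where

  private
    module K = RealQuadraticField K
  open PeriodicCF P
  open PCF P
  open PCFProperties P
  open Matrices K.commutativeRing using (e₁₁; e₁₂; e₂₁; e₂₂)
  open OrderedProperties A hiding (solve; _:=_; con; _:+_; _:*_; :-_; _:-_; 4·≈4*)
  open IsRingHomomorphism σ-isRingHomomorphism
  open Algebra.Definitions.RawMonoid K.+-rawMonoid using () renaming (_×_ to _·ᴷ_)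
  open Algebra.Definitions.RawMonoid +-rawMonoid using () renaming (_×_ to _·_)
  private
    module Eσ = LinearMap (σ (e₁₁ E)) (σ (e₁₂ E)) (σ (e₂₁ E)) (σ (e₂₂ E))

  x y : ℕ → Carrier
  x n = σ (numerator n)
  y n = σ (denominator n)

  σ-homo-- : ∀ u v → σ (u K.- v) ≈ σ u - σ v
  σ-homo-- u v = trans (+-homo u (K.- v)) (+-congˡ (-‿homo v))

  σ-homo-· : ∀ n u → σ (n ·ᴷ u) ≈ n · σ u
  σ-homo-· zero    u = 0#-homo
  σ-homo-· (suc n) u = trans (+-homo u (n ·ᴷ u)) (+-congˡ (σ-homo-· n u))

  ·-cong : ∀ n {u v} → u ≈ v → n · u ≈ n · v
  ·-cong zero    _   = refl
  ·-cong (suc n) u≈v = +-cong u≈v (·-cong n u≈v)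

  σ-square : ∀ {u v} → σ u ≈ v → σ (u K.* u) ≈ v * v
  σ-square {u} h = trans (*-homo u u) (*-cong h h)

  σ-combination : ∀ u v u′ v′ → σ (u K.* u′ K.+ v K.* v′) ≈ σ u * σ u′ + σ v * σ v′
  σ-combination u v u′ v′ = trans (+-homo _ _) (+-cong (*-homo u u′) (*-homo v v′))

  σ-Δ : σ Δ ≈ Eσ.Δ
  σ-Δ = trans (+-homo _ _) (+-cong (σ-square (σ-homo-- (e₂₂ E) (e₁₁ E)))
    (trans (σ-homo-· 4 (e₁₂ E K.* e₂₁ E)) (·-cong 4 (*-homo (e₁₂ E) (e₂₁ E)))))

  σ-det : (σ (e₁₁ E) * σ (e₂₂ E) - σ (e₁₂ E) * σ (e₂₁ E)) *
          (σ (e₁₁ E) * σ (e₂₂ E) - σ (e₁₂ E) * σ (e₂₁ E)) ≈ 1#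
  σ-det = trans (sym (σ-square (trans (σ-homo-- _ _)
      (+-cong (*-homo _ _) (-‿cong (*-homo _ _)))))) (trans (⟦⟧-cong E-unimodular) 1#-homo)

  σ-Φ : ∀ n → σ (Φ n) ≈ Eσ.Φ (x n) (y n)
  σ-Φ n = trans (σ-homo-- _ _) (+-cong
    (σ-square (trans (σ-combination _ _ _ _)
      (+-cong (*-congʳ (+-homo _ _)) (*-congʳ (σ-homo-- _ _)))))
    (-‿cong (trans (*-homo _ _) (*-cong σ-Δ (*-homo _ _)))))

  σ-square-pos : ∀ {u} → ¬ u K.≈ K.0# → Pos (σ u * σ u)
  σ-square-pos {u} u≉0 = let v , uv≈1 = K.inverse u u≉0 in
    unit⇒square-pos (trans (sym (*-homo u v)) (trans (⟦⟧-cong uv≈1) 1#-homo))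

  x-shift : ∀ n → N ℕ.≤ n → x (n ℕ.+ k) ≈ Eσ.actˣ (x n) (y n)
  x-shift n N≤n = trans (⟦⟧-cong (proj₁ (convergent-shift n N≤n))) (σ-combination _ _ _ _)

  y-shift : ∀ n → N ℕ.≤ n → y (n ℕ.+ k) ≈ Eσ.actʸ (x n) (y n)
  y-shift n N≤n = trans (⟦⟧-cong (proj₂ (convergent-shift n N≤n))) (σ-combination _ _ _ _)

  converges : Pos (σ Δ) → ¬ K.IsSquare Δ → ∃[ px ] ∃[ py ] Pos (norm² px py) ×
    (∀ {e} → Pos e → Eventually λ n →
      Pos (e * (norm² (x n) (y n) * norm² px py) - det (x n) (y n) px py * det (x n) (y n) px py))
  converges 0<Δ ¬sq =
    let px , py , 0<p , attract = Eσ.attractor σ-det (pos-resp σ-Δ 0<Δ)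
          (pos-resp (*-cong (+-homo _ _) (+-homo _ _)) (σ-square-pos trace≉0))
          (σ-square-pos (e₂₁≉0 ¬sq))
    in px , py , 0<p , λ 0<e → eventually-by-residues N k k≥1 λ m N≤m →
      let at = λ j → m ℕ.+ j ℕ.* k
          N≤at = λ j → ℕ.≤-trans N≤m (ℕ.m≤m+n m (j ℕ.* k))
      in attract (λ j → x (at j)) (λ j → y (at j))
           (λ j → trans (reflexive (≡.cong x (next m j))) (x-shift (at j) (N≤at j)))
           (λ j → trans (reflexive (≡.cong y (next m j))) (y-shift (at j) (N≤at j)))
           (pos-resp (*-cong (σ-Φ (at 0)) (σ-Φ (at 0))) (σ-square-pos (Φ≉0 ¬sq (at 0))))
           0<e
    where
    next : ∀ m j → m ℕ.+ suc j ℕ.* k ≡ m ℕ.+ j ℕ.* k ℕ.+ k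
    next m j = ≡.trans (≡.cong (m ℕ.+_) (ℕ.+-comm k (j ℕ.* k))) (≡.sym (ℕ.+-assoc m (j ℕ.* k) k))
    -- A zero trace would make σ Δ + 2² vanish, but this is positive together with σ Δ.
    trace≉0 : ¬ e₁₁ E K.+ e₂₂ E K.≈ K.0#
    trace≉0 t≈0 = ¬pos-0 (pos-resp
      (trans (trans (+-congˡ (sym (*-homo 2ᴷ 2ᴷ))) (sym (+-homo Δ _)))
        (trans (⟦⟧-cong (trace≈0⇒Δ≈-4 ¬sq t≈0)) 0#-homo))
      (pos-+² (σ 2ᴷ) 0<Δ))
      where
      2ᴷ : K.Carrier
      2ᴷ = K.ι (+ 2 ℚ./ 1)

  diverges : Pos (- σ Δ) → ∃[ ε ] 0ℚ ℚ.< ε × (∀ z₁ z₂ w₁ w₂ n → N ℕ.≤ n →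
    Pos (norm² z₁ z₂ + norm² w₁ w₂) → Close (ι ε) (x n) (y n) z₁ z₂ w₁ w₂ →
    ¬ Close (ι ε) (x (n ℕ.+ k)) (y (n ℕ.+ k)) z₁ z₂ w₁ w₂)
  diverges Δ<0 =
    let ε , 0<ε , separate = Eσ.separation (pos-resp (-‿cong σ-Δ) Δ<0)
    in ε , 0<ε , λ _ _ _ _ n N≤n 0<p close close′ →
         separate 0<p close (close-resp (x-shift n N≤n) (y-shift n N≤n) close′)

-- The real numbers

open import Data.Rational.Base using (½; ∣_∣; mkℚ; toℚᵘ; _+_; _*_; _-_; -_; _<_; _≤_)
open ≡ using (refl; sym; trans; cong; subst; subst₂)
open import Tactic.RingSolver using (solve)
open import Algebra.Definitions.RawMonoid ℚ.+-0-rawMonoid using () renaming (_×_ to _·ℚ_)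
open import Algebra.Definitions.RawMonoid ℚ.*-1-rawMonoid using () renaming (_×_ to _×ℚ*_)

acr : Tactic.AlmostCommutativeRing 0ℓ 0ℓ
acr = Tactic.fromCommutativeRing ℚ.+-*-commutativeRing (λ q → dec⇒maybe (0ℚ ℚ.≟ q))

-- Inequalities between rational numbers

0<-respʳ : ∀ {p q} → p ≡ q → 0ℚ < p → 0ℚ < q
0<-respʳ = subst (0ℚ <_)

<⇒0<- : ∀ {p q} → p < q → 0ℚ < q - p
<⇒0<- {p} {q} p<q = subst (_< q - p) (ℚ.+-inverseʳ p) (ℚ.+-monoˡ-< (- p) p<q)

0<-⇒< : ∀ {p q} → 0ℚ < q - p → p < q
0<-⇒< {p} {q} h = subst₂ _<_ (ℚ.+-identityˡ p) (lemma q p) (ℚ.+-monoˡ-< p h)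
  where
  lemma : ∀ q p → (q + - p) + p ≡ q
  lemma q p = solve (q ∷ p ∷ []) acr

≤⇒0≤- : ∀ {p q} → p ≤ q → 0ℚ ≤ q - p
≤⇒0≤- {p} {q} p≤q = subst (_≤ q - p) (ℚ.+-inverseʳ p) (ℚ.+-monoˡ-≤ (- p) p≤q)

0<+ : ∀ {p q} → 0ℚ < p → 0ℚ < q → 0ℚ < p + q
0<+ = ℚ.+-mono-<

0<+≤ : ∀ {p q} → 0ℚ < p → 0ℚ ≤ q → 0ℚ < p + q
0<+≤ = ℚ.+-mono-<-≤

0≤+ : ∀ {p q} → 0ℚ ≤ p → 0ℚ ≤ q → 0ℚ ≤ p + q
0≤+ = ℚ.+-mono-≤

0<* : ∀ {p q} → 0ℚ < p → 0ℚ < q → 0ℚ < p * q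
0<* {p} {q} hp hq =
  ℚ.positive⁻¹ (p * q) ⦃ ℚ.pos*pos⇒pos p ⦃ ℚ.positive hp ⦄ q ⦃ ℚ.positive hq ⦄ ⦄

0≤* : ∀ {p q} → 0ℚ ≤ p → 0ℚ ≤ q → 0ℚ ≤ p * q
0≤* {p} {q} hp hq = subst (_≤ p * q) (ℚ.*-zeroʳ p) (ℚ.*-monoˡ-≤-nonNeg p ⦃ ℚ.nonNegative hp ⦄ hq)

0≤p² : ∀ p → 0ℚ ≤ p * p
0≤p² p with ℚ.≤-total 0ℚ p
... | inj₁ 0≤p = 0≤* 0≤p 0≤p
... | inj₂ p≤0 = subst (0ℚ ≤_) (lemma p) (0≤* 0≤-p 0≤-p)
  where
  0≤-p : 0ℚ ≤ - p
  0≤-p = ℚ.neg-antimono-≤ p≤0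
  lemma : ∀ p → - p * - p ≡ p * p
  lemma p = solve (p ∷ []) acr

0<½* : ∀ {p} → 0ℚ < p → 0ℚ < ½ * p
0<½* = 0<* (ℚ.positive⁻¹ ½)

½+½ : ∀ p → ½ * p + ½ * p ≡ p
½+½ p = trans (sym (ℚ.*-distribʳ-+ p ½ ½)) (ℚ.*-identityˡ p)

divide : ∀ {b ε} → 0ℚ < b → 0ℚ < ε → ∃[ δ ] 0ℚ < δ × b * δ ≡ ε
divide {b} {ε} 0<b 0<ε = ℚ.1/ b * ε , 0<* (ℚ.positive⁻¹ (ℚ.1/ b) ⦃ ℚ.1/pos⇒pos b ⦄) 0<ε ,
    trans (sym (ℚ.*-assoc b (ℚ.1/ b) ε)) (trans (cong (_* ε) (ℚ.*-inverseʳ b)) (ℚ.*-identityˡ ε))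
  where
  instance
    b-pos : ℚ.Positive b
    b-pos = ℚ.positive 0<b
    b-nonZero : ℚ.NonZero b
    b-nonZero = ℚ.pos⇒nonZero b

p≤∣p∣ : ∀ p → p ≤ ∣ p ∣
p≤∣p∣ p with ℚ.≤-total 0ℚ p
... | inj₁ 0≤p = ℚ.≤-reflexive (sym (ℚ.0≤p⇒∣p∣≡p 0≤p))
... | inj₂ p≤0 = ℚ.≤-trans p≤0 (ℚ.0≤∣p∣ p)

-p≤∣p∣ : ∀ p → - p ≤ ∣ p ∣
-p≤∣p∣ p = subst (- p ≤_) (ℚ.∣-p∣≡∣p∣ p) (p≤∣p∣ (- p))

∣p∣<-intro : ∀ {p ε} → p < ε → - p < ε → ∣ p ∣ < ε
∣p∣<-intro {p} {ε} hp h-p with ℚ.∣p∣≡p∨∣p∣≡-p p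
... | inj₁ e = subst (_< ε) (sym e) hp
... | inj₂ e = subst (_< ε) (sym e) h-p

-- Null sequences and equality of reals

Null : (ℕ → ℚ) → Set
Null z = ∀ ε → 0ℚ < ε → Eventually λ n → ∣ z n ∣ < ε

Bounded : (ℕ → ℚ) → Set
Bounded x = ∃[ b ] 0ℚ < b × Eventually λ n → ∣ x n ∣ ≤ b

cauchy⇒bounded : ∀ x → IsCauchy x → Bounded x
cauchy⇒bounded x cx with cx 1ℚ (ℚ.positive⁻¹ 1ℚ)
... | n₀ , h = 1ℚ + ∣ x n₀ ∣ , 0<+≤ (ℚ.positive⁻¹ 1ℚ) (ℚ.0≤∣p∣ (x n₀)) , n₀ , λ n hn →
  let open ℚ.≤-Reasoning in begin
    ∣ x n ∣                     ≡⟨ cong ∣_∣ (restore (x n) (x n₀)) ⟩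
    ∣ (x n - x n₀) + x n₀ ∣     ≤⟨ ℚ.∣p+q∣≤∣p∣+∣q∣ (x n - x n₀) (x n₀) ⟩
    ∣ x n - x n₀ ∣ + ∣ x n₀ ∣   ≤⟨ ℚ.+-monoˡ-≤ ∣ x n₀ ∣ (ℚ.<⇒≤ (h n n₀ hn ℕ.≤-refl)) ⟩
    1ℚ + ∣ x n₀ ∣               ∎
  where
  restore : ∀ a b → a ≡ (a + - b) + b
  restore a b = solve (a ∷ b ∷ []) acr

null-resp-≗ : ∀ {y z} → (∀ n → z n ≡ y n) → Null y → Null z
null-resp-≗ e hy ε 0<ε = ev-map (λ n → subst (_< ε) (cong ∣_∣ (sym (e n)))) (hy ε 0<ε)

null-0 : Null (λ _ → 0ℚ)
null-0 ε 0<ε = always λ _ → 0<ε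

null-+ : ∀ y z → Null y → Null z → Null (λ n → y n + z n)
null-+ y z hy hz ε 0<ε = ev-zip
  (λ n h k → ℚ.≤-<-trans (ℚ.∣p+q∣≤∣p∣+∣q∣ (y n) (z n)) (subst (_ <_) (½+½ ε) (ℚ.+-mono-< h k)))
  (hy (½ * ε) (0<½* 0<ε)) (hz (½ * ε) (0<½* 0<ε))

null-neg : ∀ z → Null z → Null (λ n → - z n)
null-neg z hz ε 0<ε = ev-map (λ n → subst (_< ε) (sym (ℚ.∣-p∣≡∣p∣ (z n)))) (hz ε 0<ε)

null-* : ∀ b z → Bounded b → Null z → Null (λ n → b n * z n)
null-* b z (B , 0<B , hb) hz ε 0<ε with divide 0<B 0<ε
... | δ , 0<δ , Bδ≡ε = ev-zip
  (λ n h k → let open ℚ.≤-Reasoning in begin-strict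
    ∣ b n * z n ∣      ≡⟨ ℚ.∣p*q∣≡∣p∣*∣q∣ (b n) (z n) ⟩
    ∣ b n ∣ * ∣ z n ∣  ≤⟨ ℚ.*-monoʳ-≤-nonNeg ∣ z n ∣ ⦃ ℚ.∣-∣-nonNeg (z n) ⦄ h ⟩
    B * ∣ z n ∣        <⟨ ℚ.*-monoʳ-<-pos B ⦃ ℚ.positive 0<B ⦄ k ⟩
    B * δ              ≡⟨ Bδ≡ε ⟩
    ε ∎)
  hb (hz δ 0<δ)

≗⇒≈ℝ : ∀ x y → (∀ n → seq x n ≡ seq y n) → x ≈ℝ y
≗⇒≈ℝ x y e = null-resp-≗ (λ n → trans (cong (_- seq y n) (e n)) (ℚ.+-inverseʳ (seq y n))) null-0

≈ℝ-sym : ∀ x y → x ≈ℝ y → y ≈ℝ x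
≈ℝ-sym x y h = null-resp-≗ (λ n → lemma (seq y n) (seq x n)) (null-neg _ h)
  where
  lemma : ∀ a b → a + - b ≡ - (b + - a)
  lemma a b = solve (a ∷ b ∷ []) acr

≈ℝ-trans : ∀ x y z → x ≈ℝ y → y ≈ℝ z → x ≈ℝ z
≈ℝ-trans x y z h k =
  null-resp-≗ (λ n → lemma (seq x n) (seq y n) (seq z n)) (null-+ _ _ h k)
  where
  lemma : ∀ a b c → a + - c ≡ (a + - b) + (b + - c)
  lemma a b c = solve (a ∷ b ∷ c ∷ []) acr

+ℝ-cong : ∀ x x′ y y′ → x ≈ℝ x′ → y ≈ℝ y′ → x +ℝ y ≈ℝ x′ +ℝ y′
+ℝ-cong x x′ y y′ h k =
  null-resp-≗ (λ n → lemma (seq x n) (seq x′ n) (seq y n) (seq y′ n)) (null-+ _ _ h k)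
  where
  lemma : ∀ a a′ b b′ → (a + b) + - (a′ + b′) ≡ (a + - a′) + (b + - b′)
  lemma a a′ b b′ = solve (a ∷ a′ ∷ b ∷ b′ ∷ []) acr

-ℝ-cong : ∀ x x′ → x ≈ℝ x′ → -ℝ x ≈ℝ -ℝ x′
-ℝ-cong x x′ h = null-resp-≗ (λ n → lemma (seq x n) (seq x′ n)) (null-neg _ h)
  where
  lemma : ∀ a a′ → - a + - (- a′) ≡ - (a + - a′)
  lemma a a′ = solve (a ∷ a′ ∷ []) acr

*ℝ-cong : ∀ x x′ y y′ → x ≈ℝ x′ → y ≈ℝ y′ → x *ℝ y ≈ℝ x′ *ℝ y′
*ℝ-cong x x′ y y′ h k =
  null-resp-≗ (λ n → lemma (seq x n) (seq x′ n) (seq y n) (seq y′ n))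
    (null-+ _ _ (null-* _ _ (cauchy⇒bounded (seq x) (cauchy x)) k)
                (null-* _ _ (cauchy⇒bounded (seq y′) (cauchy y′)) h))
  where
  lemma : ∀ a a′ b b′ → a * b + - (a′ * b′) ≡ a * (b + - b′) + b′ * (a + - a′)
  lemma a a′ b b′ = solve (a ∷ a′ ∷ b ∷ b′ ∷ []) acr

-- Positive reals

Posℝ : ℝ → Set
Posℝ x = 0ℝ <ℝ x

pos-intro : ∀ {x} → (∃[ ε ] 0ℚ < ε × Eventually λ n → ε < seq x n) → Posℝ x
pos-intro {x} (ε , 0<ε , h) =
  ε , 0<ε , ev-map (λ n → subst (_< seq x n) (sym (ℚ.+-identityˡ ε))) h

pos-elim : ∀ {x} → Posℝ x → ∃[ ε ] 0ℚ < ε × Eventually λ n → ε < seq x n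
pos-elim {x} (ε , 0<ε , h) =
  ε , 0<ε , ev-map (λ n → subst (_< seq x n) (ℚ.+-identityˡ ε)) h

<ℝ⇒pos : ∀ x y → x <ℝ y → Posℝ (y +ℝ -ℝ x)
<ℝ⇒pos x y (ε , 0<ε , h) = pos-intro {y +ℝ -ℝ x} (ε , 0<ε , ev-map
  (λ n k → 0<-⇒< (0<-respʳ (lemma (seq x n) (seq y n) ε) (<⇒0<- k))) h)
  where
  lemma : ∀ a b ε → b + - (a + ε) ≡ (b + - a) + - ε
  lemma a b ε = solve (a ∷ b ∷ ε ∷ []) acr

pos⇒<ℝ : ∀ x y → Posℝ (y +ℝ -ℝ x) → x <ℝ y
pos⇒<ℝ x y h with pos-elim {y +ℝ -ℝ x} h
... | ε , 0<ε , k = ε , 0<ε , ev-map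
  (λ n l → 0<-⇒< (0<-respʳ (lemma (seq x n) (seq y n) ε) (<⇒0<- l))) k
  where
  lemma : ∀ a b ε → (b + - a) + - ε ≡ b + - (a + ε)
  lemma a b ε = solve (a ∷ b ∷ ε ∷ []) acr

-- Half of the lower bound survives once the sequences differ by less than the other half.
pos-resp-≈ : ∀ x y → x ≈ℝ y → Posℝ x → Posℝ y
pos-resp-≈ x y x≈y px with pos-elim {x} px
... | ε , 0<ε , h = pos-intro {y} (½ * ε , 0<½* 0<ε , ev-zip
  (λ n k l → 0<-⇒< (0<-respʳ
     (trans (lemma (seq x n) (seq y n) (½ * ε) ε)
       (trans (cong (λ t → (seq y n - ½ * ε) + (t - ε)) (½+½ ε)) (lemma′ (seq y n - ½ * ε) ε)))
     (0<+ (<⇒0<- k) (<⇒0<- (ℚ.≤-<-trans (p≤∣p∣ (seq x n - seq y n)) l)))))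
  h (x≈y (½ * ε) (0<½* 0<ε)))
  where
  lemma : ∀ a b η ε → (a + - ε) + (η + - (a + - b)) ≡ (b + - η) + ((η + η) + - ε)
  lemma a b η ε = solve (a ∷ b ∷ η ∷ ε ∷ []) acr
  lemma′ : ∀ a ε → a + (ε + - ε) ≡ a
  lemma′ a ε = solve (a ∷ ε ∷ []) acr

pos-+ : ∀ x y → Posℝ x → Posℝ y → Posℝ (x +ℝ y)
pos-+ x y px py with pos-elim {x} px | pos-elim {y} py
... | ε , 0<ε , h | δ , 0<δ , k =
  pos-intro {x +ℝ y} (ε + δ , 0<+ 0<ε 0<δ , ev-zip (λ n → ℚ.+-mono-<) h k)

pos-* : ∀ x y → Posℝ x → Posℝ y → Posℝ (x *ℝ y)
pos-* x y px py with pos-elim {x} px | pos-elim {y} py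
... | ε , 0<ε , h | δ , 0<δ , k = pos-intro {x *ℝ y} (ε * δ , 0<* 0<ε 0<δ , ev-zip
  (λ n a b → 0<-⇒< (0<-respʳ (lemma (seq x n) (seq y n) ε δ)
     (0<+ (0<* (<⇒0<- a) (ℚ.<-trans 0<δ b)) (0<* 0<ε (<⇒0<- b))))) h k)
  where
  lemma : ∀ a b ε δ → (a + - ε) * b + ε * (b + - δ) ≡ a * b + - (ε * δ)
  lemma a b ε δ = solve (a ∷ b ∷ ε ∷ δ ∷ []) acr

pos-+² : ∀ x y → Posℝ x → Posℝ (x +ℝ y *ℝ y)
pos-+² x y px with pos-elim {x} px
... | ε , 0<ε , h = pos-intro {x +ℝ y *ℝ y} (ε , 0<ε , ev-map
  (λ n k → subst (_< _) (ℚ.+-identityʳ ε) (ℚ.+-mono-<-≤ k (0≤p² (seq y n)))) h)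

¬pos-0 : ¬ Posℝ 0ℝ
¬pos-0 p with pos-elim {0ℝ} p
... | ε , 0<ε , n₀ , h = ℚ.<-asym 0<ε (h n₀ ℕ.≤-refl)

pos-fromℚ : ∀ q → 0ℚ < q → Posℝ (fromℚ q)
pos-fromℚ q 0<q with ℚ.<-dense 0<q
... | ε , 0<ε , ε<q = pos-intro {fromℚ q} (ε , 0<ε , always λ _ → ε<q)

above : ∀ x → ∃[ b ] 0ℚ < b × Eventually λ n → seq x n ≤ b
above x =
  let b , 0<b , h = cauchy⇒bounded (seq x) (cauchy x)
  in b , 0<b , ev-map (λ n h → ℚ.≤-trans {seq x n} {∣ seq x n ∣} {b} (p≤∣p∣ (seq x n)) h) h

-- If ε < x y² and y² ≤ b, then x > ε / b, since a smaller x would give x y² ≤ ε.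
pos-cancel² : ∀ x y → Posℝ (x *ℝ (y *ℝ y)) → Posℝ x
pos-cancel² x y p =
  let ε , 0<ε , h      = pos-elim {x *ℝ (y *ℝ y)} p
      b , 0<b , k      = above (y *ℝ y)
      δ , 0<δ , bδ≡ε   = divide 0<b 0<ε
  in pos-intro {x} (δ , 0<δ , ev-zip (λ n → step b δ ε (seq x n) (seq y n) 0<δ bδ≡ε) h k)
  where
  lemma : ∀ a y δ b →
    (a * (y * y) + - (b * δ)) + ((δ + - a) * (y * y) + δ * (b + - (y * y))) ≡ 0ℚ
  lemma a y δ b = solve (a ∷ y ∷ δ ∷ b ∷ []) acr
  step : ∀ b δ ε a y → 0ℚ < δ → b * δ ≡ ε → ε < a * (y * y) → y * y ≤ b → δ < a
  step b δ ε a y 0<δ bδ≡ε l m with δ ℚ.<? a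
  ... | yes δ<a = δ<a
  ... | no δ≮a = contradiction
    (0<-respʳ (trans (cong (λ t → (a * (y * y) - t) + ((δ - a) * (y * y) + δ * (b - y * y))) (sym bδ≡ε))
                     (lemma a y δ b))
      (0<+≤ (<⇒0<- l) (0≤+ (0≤* (≤⇒0≤- (ℚ.≮⇒≥ δ≮a)) (0≤p² y)) (0≤* (ℚ.<⇒≤ 0<δ) (≤⇒0≤- m)))))
    (ℚ.<-irrefl refl)

abs-large : ∀ {b δ ε} a → 0ℚ < b → b * δ ≡ ε → ε < a * a → ∣ a ∣ ≤ b → δ < ∣ a ∣
abs-large {b} {δ} {ε} a 0<b bδ≡ε l m with δ ℚ.<? ∣ a ∣
... | yes q = q
... | no q = contradiction (let open ℚ.≤-Reasoning in begin-strict
  ε              <⟨ l ⟩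
  a * a          ≤⟨ p≤∣p∣ (a * a) ⟩
  ∣ a * a ∣      ≡⟨ ℚ.∣p*q∣≡∣p∣*∣q∣ a a ⟩
  ∣ a ∣ * ∣ a ∣  ≤⟨ ℚ.*-monoʳ-≤-nonNeg ∣ a ∣ ⦃ ℚ.∣-∣-nonNeg a ⦄ m ⟩
  b * ∣ a ∣      ≤⟨ ℚ.*-monoˡ-≤-nonNeg b ⦃ ℚ.pos⇒nonNeg b ⦃ ℚ.positive 0<b ⦄ ⦄ (ℚ.≮⇒≥ q) ⟩
  b * δ          ≡⟨ bδ≡ε ⟩
  ε              ∎) (ℚ.<-irrefl refl)

stays-positive : ∀ {δ} a a′ → δ < a → - (a′ + - a) < δ → δ < ∣ a′ ∣ → δ < a′
stays-positive {δ} a a′ δ<a close large = subst (δ <_) (ℚ.0≤p⇒∣p∣≡p (ℚ.<⇒≤ 0<a′)) large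
  where
  lemma : ∀ a a′ δ → (a + - δ) + (δ + - (- (a′ + - a))) ≡ a′
  lemma a a′ δ = solve (a ∷ a′ ∷ δ ∷ []) acr
  0<a′ : 0ℚ < a′
  0<a′ = 0<-respʳ (lemma a a′ δ) (0<+ (<⇒0<- δ<a) (<⇒0<- close))

-- The positive square keeps |x| above some `δ`. Once the sequence varies by less than `δ` it cannot
-- change sign, so the single rational number at index `i` decides.
sign : ∀ x → Posℝ (x *ℝ x) → Posℝ x ⊎ Posℝ (-ℝ x)
sign x p = decide (ℚ.∣p∣≡p∨∣p∣≡-p (seq x i))
  where
  x²-pos : ∃[ ε ] 0ℚ < ε × Eventually λ n → ε < seq (x *ℝ x) n
  x²-pos = pos-elim {x *ℝ x} p
  bound : Bounded (seq x)
  bound = cauchy⇒bounded (seq x) (cauchy x)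
  gap : ∃[ δ ] 0ℚ < δ × proj₁ bound * δ ≡ proj₁ x²-pos
  gap = divide (proj₁ (proj₂ bound)) (proj₁ (proj₂ x²-pos))
  δ : ℚ
  δ = proj₁ gap
  0<δ : 0ℚ < δ
  0<δ = proj₁ (proj₂ gap)
  large : Eventually λ n → δ < ∣ seq x n ∣
  large = ev-zip (λ n → abs-large (seq x n) (proj₁ (proj₂ bound)) (proj₂ (proj₂ gap)))
                 (proj₂ (proj₂ x²-pos)) (proj₂ (proj₂ bound))
  m n i : ℕ
  m = proj₁ large
  n = proj₁ (cauchy x δ 0<δ)
  i = m ℕ.⊔ n
  large′ : ∀ j → i ℕ.≤ j → δ < ∣ seq x j ∣
  large′ j i≤j = proj₂ large j (ℕ.m⊔n≤o⇒m≤o m n i≤j)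
  close : ∀ j → i ℕ.≤ j → ∣ seq x j - seq x i ∣ < δ
  close j i≤j = proj₂ (cauchy x δ 0<δ) j i (ℕ.m⊔n≤o⇒n≤o m n i≤j) (ℕ.m⊔n≤o⇒n≤o m n ℕ.≤-refl)
  neg-diff : ∀ a a′ → a′ + - a ≡ - (- a′ + - (- a))
  neg-diff a a′ = solve (a ∷ a′ ∷ []) acr
  decide : ∣ seq x i ∣ ≡ seq x i ⊎ ∣ seq x i ∣ ≡ - seq x i → Posℝ x ⊎ Posℝ (-ℝ x)
  decide (inj₁ e) = inj₁ (pos-intro {x} (δ , 0<δ , i , λ j i≤j →
    stays-positive (seq x i) (seq x j)
      (subst (δ <_) e (large′ i ℕ.≤-refl))
      (ℚ.≤-<-trans (-p≤∣p∣ (seq x j - seq x i)) (close j i≤j))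
      (large′ j i≤j)))
  decide (inj₂ e) = inj₂ (pos-intro { -ℝ x} (δ , 0<δ , i , λ j i≤j →
    stays-positive (- seq x i) (- seq x j)
      (subst (δ <_) e (large′ i ℕ.≤-refl))
      (subst (_< δ) (neg-diff (seq x i) (seq x j))
        (ℚ.≤-<-trans (p≤∣p∣ (seq x j - seq x i)) (close j i≤j)))
      (subst (δ <_) (sym (ℚ.∣-p∣≡∣p∣ (seq x j))) (large′ j i≤j))))

-- Growth of powers

infixl 8 _^ℚ_
_^ℚ_ : ℚ → ℕ → ℚ
q ^ℚ n = n ×ℚ* q

0≤·ℚ : ∀ n {q} → 0ℚ ≤ q → 0ℚ ≤ n ·ℚ q
0≤·ℚ zero    _   = ℚ.≤-refl
0≤·ℚ (suc n) 0≤q = 0≤+ 0≤q (0≤·ℚ n 0≤q)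

·ℚ-mono : ∀ {m n q} → 0ℚ ≤ q → m ℕ.≤ n → m ·ℚ q ≤ n ·ℚ q
·ℚ-mono {n = n} 0≤q ℕ.z≤n = 0≤·ℚ n 0≤q
·ℚ-mono {q = q} 0≤q (ℕ.s≤s m≤n) = ℚ.+-monoʳ-≤ q (·ℚ-mono 0≤q m≤n)

·ℚ-assoc-* : ∀ n p q → n ·ℚ (p * q) ≡ n ·ℚ p * q
·ℚ-assoc-* zero    p q = sym (ℚ.*-zeroˡ q)
·ℚ-assoc-* (suc n) p q =
  trans (cong (λ t → p * q + t) (·ℚ-assoc-* n p q)) (sym (ℚ.*-distribʳ-+ q p (n ·ℚ p)))

toℚᵘ-·1 : ∀ n → toℚᵘ (n ·ℚ 1ℚ) ℚᵘ.≃ ℚᵘ.mkℚᵘ (+ n) 0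
toℚᵘ-·1 zero    = ℚᵘ.*≡* refl
toℚᵘ-·1 (suc n) = ℚᵘ.≃-trans (ℚ.toℚᵘ-homo-+ 1ℚ (n ·ℚ 1ℚ))
  (ℚᵘ.≃-trans (ℚᵘ.+-congʳ ℚᵘ.1ℚᵘ (toℚᵘ-·1 n))
    (ℚᵘ.*≡* (cong (ℤ._* + 1) (cong (λ t → + 1 ℤ.+ t) (ℤ.*-identityʳ (+ n))))))

archimedean₁ : ∀ q → ∃[ n ] q < n ·ℚ 1ℚ
archimedean₁ q@(mkℚ _ _ _) = n , ℚ.toℚᵘ-cancel-< (ℚᵘ.<-respʳ-≃ (ℚᵘ.≃-sym (toℚᵘ-·1 n))
  (ℚᵘ.*<* (begin-strict
    ℚ.↥ q ℤ.* + 1                     ≡⟨ ℤ.*-identityʳ (ℚ.↥ q) ⟩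
    ℚ.↥ q                             ≤⟨ i≤∣i∣ (ℚ.↥ q) ⟩
    + ℤ.∣ ℚ.↥ q ∣                     <⟨ ℤ.+<+ (ℕ.n<1+n _) ⟩
    + n                               ≤⟨ ℤ.+≤+ (ℕ.m≤m*n n (ℚ.↧ₙ q)) ⟩
    + (n ℕ.* ℚ.↧ₙ q)                  ≡⟨ ℤ.pos-* n (ℚ.↧ₙ q) ⟩
    + n ℤ.* ℚ.↧ q                     ∎)))
  where
  open ℤ.≤-Reasoning
  n : ℕ
  n = suc ℤ.∣ ℚ.↥ q ∣
  i≤∣i∣ : ∀ i → i ℤ.≤ + ℤ.∣ i ∣
  i≤∣i∣ (+ n)      = ℤ.≤-refl
  i≤∣i∣ ℤ.-[1+ n ] = ℤ.-≤+

archimedean : ∀ {h} q → 0ℚ < h → ∃[ n ] q < n ·ℚ h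
archimedean {h} q 0<h =
  let δ , 0<δ , hδ≡1 = divide 0<h (ℚ.positive⁻¹ 1ℚ)
      n , l          = archimedean₁ (q * δ)
  in n , subst₂ _<_
    (trans (ℚ.*-assoc q δ h) (trans (cong (q *_) (trans (ℚ.*-comm δ h) hδ≡1)) (ℚ.*-identityʳ q)))
    (trans (sym (·ℚ-assoc-* n 1ℚ h)) (cong (n ·ℚ_) (ℚ.*-identityˡ h)))
    (ℚ.*-monoˡ-<-pos h ⦃ ℚ.positive 0<h ⦄ l)

bernoulli : ∀ {h q} → 0ℚ < h → h < q - 1ℚ → ∀ n → 0ℚ ≤ q ^ℚ n - (1ℚ + n ·ℚ h)
bernoulli 0<h _ zero = ℚ.≤-refl
bernoulli {h} {q} 0<h h<q-1 (suc n) = subst (0ℚ ≤_) (lemma h q (q ^ℚ n) (n ·ℚ h))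
  (0≤+ (0≤* (ℚ.<⇒≤ (<⇒0<- h<q-1)) (0≤+ (0≤+ ih 0≤1) 0≤J))
    (0≤+ (0≤* (0≤+ 0≤1 0≤h) ih) (0≤* 0≤h 0≤J)))
  where
  0≤1 : 0ℚ ≤ 1ℚ
  0≤1 = ℚ.<⇒≤ (ℚ.positive⁻¹ 1ℚ)
  0≤h : 0ℚ ≤ h
  0≤h = ℚ.<⇒≤ 0<h
  0≤J : 0ℚ ≤ n ·ℚ h
  0≤J = 0≤·ℚ n 0≤h
  ih : 0ℚ ≤ q ^ℚ n - (1ℚ + n ·ℚ h)
  ih = bernoulli 0<h h<q-1 n
  lemma : ∀ h q P J →
    ((q + - 1ℚ) + - h) * (((P + - (1ℚ + J)) + 1ℚ) + J) + ((1ℚ + h) * (P + - (1ℚ + J)) + h * J)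
    ≡ q * P + - (1ℚ + (h + J))
  lemma h q P J = solve (h ∷ q ∷ P ∷ J ∷ []) acr

open import Algebra.Definitions.RawMonoid (RawRing.*-rawMonoid ℝ-rawRing)
  using () renaming (_×_ to _×ℝ*_)

seq-^ : ∀ x j n → seq (j ×ℝ* x) n ≡ seq x n ^ℚ j
seq-^ x zero    n = refl
seq-^ x (suc j) n = cong (seq x n *_) (seq-^ x j n)

growth : ∀ q b a → Posℝ (q +ℝ -ℝ 1ℝ) → Posℝ b →
  ∃[ j₀ ] ∀ j → j₀ ℕ.≤ j → Posℝ ((j ×ℝ* q) *ℝ b +ℝ -ℝ a)
growth q b a hq hb =
  let h , 0<h , h<q-1 = pos-elim {q +ℝ -ℝ 1ℝ} hq
      β , 0<β , β<b   = pos-elim {b} hb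
      α , _ , a≤α     = above a
      -- By Bernoulli's inequality qʲ b ≥ (1 + j h) β > α + 1, which leaves the margin 1 above `a`.
      j₀ , big        = archimedean (α + 1ℚ) (0<* 0<h 0<β)
  in j₀ , λ j j₀≤j → pos-intro {(j ×ℝ* q) *ℝ b +ℝ -ℝ a} (1ℚ , ℚ.positive⁻¹ 1ℚ , ev-zip
    (λ n l → λ where
      (m , k) → 0<-⇒< (subst (λ t → 0ℚ < (t * seq b n - seq a n) - 1ℚ) (sym (seq-^ q j n))
        (step j (seq q n) (seq a n) (seq b n) 0<h 0<β l
          (subst (α + 1ℚ <_) (·ℚ-assoc-* j h β)
            (ℚ.<-≤-trans big (·ℚ-mono (ℚ.<⇒≤ (0<* 0<h 0<β)) j₀≤j)))
          m k)))
    h<q-1 (ev-zip (λ _ → _,_) β<b a≤α))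
  where
  lemma : ∀ P J A B α β →
    (P + - (1ℚ + J)) * B + ((1ℚ + J) * (B + - β) + (β + ((J * β + - (α + 1ℚ)) + (α + - A))))
    ≡ (P * B + - A) + - 1ℚ
  lemma P J A B α β = solve (P ∷ J ∷ A ∷ B ∷ α ∷ β ∷ []) acr
  step : ∀ {h α β} j Q A B → 0ℚ < h → 0ℚ < β → h < Q - 1ℚ → α + 1ℚ < j ·ℚ h * β →
    β < B → A ≤ α → 0ℚ < (Q ^ℚ j * B - A) - 1ℚ
  step {h} {α} {β} j Q A B 0<h 0<β h<Q-1 large β<B A≤α =
    0<-respʳ (lemma (Q ^ℚ j) (j ·ℚ h) A B α β)
      (ℚ.+-mono-≤-< (0≤* (bernoulli 0<h h<Q-1 j) (ℚ.<⇒≤ (ℚ.<-trans 0<β β<B)))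
        (ℚ.+-mono-≤-< (0≤* (0≤+ (ℚ.<⇒≤ (ℚ.positive⁻¹ 1ℚ)) (0≤·ℚ j (ℚ.<⇒≤ 0<h))) (ℚ.<⇒≤ (<⇒0<- β<B)))
          (0<+ 0<β (0<+≤ (<⇒0<- large) (≤⇒0≤- A≤α)))))

-- With η below y and b above x, the choice ε = η / (2 b) makes ε x cost at most half of η.
small-multiple : ∀ x y → Posℝ y → ∃[ ε ] 0ℚ < ε × Posℝ (y +ℝ -ℝ (fromℚ ε *ℝ x))
small-multiple x y hy =
  let η , 0<η , η<y     = pos-elim {y} hy
      b , 0<b , x≤b     = above x
      ε , 0<ε , bε≡½η   = divide 0<b (0<½* 0<η)
  in ε , 0<ε , pos-intro {y +ℝ -ℝ (fromℚ ε *ℝ x)} (½ * η , 0<½* 0<η , ev-zip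
    (λ n → step η b ε (seq x n) (seq y n) 0<ε bε≡½η) η<y x≤b)
  where
  lemma : ∀ X Y ε b η → (Y + - (η + b * ε)) + ε * (b + - X) ≡ (Y + - (ε * X)) + - η
  lemma X Y ε b η = solve (X ∷ Y ∷ ε ∷ b ∷ η ∷ []) acr
  step : ∀ η b ε X Y → 0ℚ < ε → b * ε ≡ ½ * η → η < Y → X ≤ b → ½ * η < Y - ε * X
  step η b ε X Y 0<ε e l m = 0<-⇒< (0<-respʳ (lemma X Y ε b (½ * η))
    (0<+≤ (0<-respʳ (cong (λ t → Y - t) (trans (sym (½+½ η)) (cong (λ t → ½ * η + t) (sym e)))) (<⇒0<- l))
          (0≤* (ℚ.<⇒≤ 0<ε) (≤⇒0≤- m))))

-- Square roots

0<1+n· : ∀ n → 0ℚ < suc n ·ℚ 1ℚ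
0<1+n· n = 0<+≤ (ℚ.positive⁻¹ 1ℚ) (0≤·ℚ n (ℚ.<⇒≤ (ℚ.positive⁻¹ 1ℚ)))

step-size : ∀ n → ∃[ τ ] 0ℚ < τ × (suc n ·ℚ 1ℚ) * τ ≡ 1ℚ
step-size n = divide (0<1+n· n) (ℚ.positive⁻¹ 1ℚ)

-- 1 / (n + 1)
τ : ℕ → ℚ
τ n = proj₁ (step-size n)

0<τ : ∀ n → 0ℚ < τ n
0<τ n = proj₁ (proj₂ (step-size n))

τ-small : ∀ ε → 0ℚ < ε → Eventually λ n → τ n < ε
τ-small ε 0<ε =
  let j , 1<jε = archimedean 1ℚ 0<ε
  in j , λ n j≤n → ℚ.*-cancelˡ-<-nonNeg (suc n ·ℚ 1ℚ)
       ⦃ ℚ.nonNegative (ℚ.<⇒≤ (0<1+n· n)) ⦄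
       (subst₂ _<_ (sym (proj₂ (proj₂ (step-size n))))
         (trans (cong (suc n ·ℚ_) (sym (ℚ.*-identityˡ ε))) (·ℚ-assoc-* (suc n) 1ℚ ε))
         (ℚ.<-≤-trans 1<jε (·ℚ-mono (ℚ.<⇒≤ 0<ε) (ℕ.m≤n⇒m≤1+n j≤n))))

last-true : ∀ {P : ℕ → Set} → Decidable P → P 0 → ∀ n → ¬ P n → ∃[ k ] P k × ¬ P (suc k)
last-true P? p₀ zero    ¬p = contradiction p₀ ¬p
last-true P? p₀ (suc n) ¬p with P? n
... | yes p = n , p , ¬p
... | no ¬q = last-true P? p₀ n ¬q

-- The root of `q` rounded down with error below `t`: r ≤ √q < r + t.
IsRoot : ℚ → ℚ → ℚ → Set
IsRoot q t r = 0ℚ ≤ r × r * r ≤ q × q < (r + t) * (r + t)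

root : ∀ {q t} → 0ℚ ≤ q → 0ℚ < t → ∃ (IsRoot q t)
root {q} {t} 0≤q 0<t =
  -- A multiple of `t` above 1 + q has a square above `q`, which ends the search for the last
  -- multiple not exceeding √q.
  let n , 1+q<nt       = archimedean (1ℚ + q) 0<t
      k , below , over = last-true {λ k → (k ·ℚ t) * (k ·ℚ t) ≤ q}
        (λ k → (k ·ℚ t) * (k ·ℚ t) ℚ.≤? q) 0≤q n
        (λ nt²≤q → ℚ.<-irrefl refl (ℚ.<-≤-trans (too-big (n ·ℚ t) 1+q<nt) nt²≤q))
  in k ·ℚ t , 0≤·ℚ k (ℚ.<⇒≤ 0<t) , below ,
     subst (λ s → q < s * s) (ℚ.+-comm t (k ·ℚ t)) (ℚ.≰⇒> over)
  where
  lemma : ∀ q y → ((y + - (1ℚ + q)) + (1ℚ + q)) * (y + - (1ℚ + q))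
    + (q * (1ℚ + q) + (y + - (1ℚ + q)) * (1ℚ + q) + 1ℚ) ≡ y * y + - q
  lemma q y = solve (q ∷ y ∷ []) acr
  0<1+q : 0ℚ < 1ℚ + q
  0<1+q = 0<+≤ (ℚ.positive⁻¹ 1ℚ) 0≤q
  too-big : ∀ y → 1ℚ + q < y → q < y * y
  too-big y l = 0<-⇒< (0<-respʳ (lemma q y)
    (0<+ (0<* (0<+ (<⇒0<- l) 0<1+q) (<⇒0<- l))
      (0<+ (ℚ.+-mono-≤-< (0≤* 0≤q (ℚ.<⇒≤ 0<1+q)) (0<* (<⇒0<- l) 0<1+q)) (ℚ.positive⁻¹ 1ℚ))))

-- A sequence needs a term at every index, also where a positive real has a negative approximation;
-- there the value is 0.
approx-root : ∀ q n → ∃[ r ] (0ℚ ≤ q → IsRoot q (τ n) r)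
approx-root q n with 0ℚ ℚ.≤? q
... | yes 0≤q = let r , h = root 0≤q (0<τ n) in r , λ _ → h
... | no  0≰q = 0ℚ , λ 0≤q → contradiction 0≤q 0≰q

-- If a ≥ b + 2 e, then a > (b + t) + e, so a² > (b + t)² + e² > q + e² > p, against a² ≤ p.
root-diff : ∀ {p q s t a b} e → 0ℚ < t → IsRoot p s a → IsRoot q t b →
  p - q < e * e → t < e → a - b < e + e
root-diff {p} {q} {s} {t} {a} {b} e 0<t (0≤a , a²≤p , _) (0≤b , _ , q<[b+t]²) p-q<e² t<e
  with (a - b) ℚ.<? (e + e)
... | yes l = l
... | no ¬l = contradiction
    (0<-respʳ (lemma p q t a b e)
      (0<+ (0<+≤ (<⇒0<- q<[b+t]²) (≤⇒0≤- a²≤p))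
        (0<+≤ (<⇒0<- p-q<e²)
          (0≤+ (0≤* 0≤e (0≤+ 0≤e+g+h+2b 0≤t))
               (0≤* (0≤+ 0≤e-t 0≤h) (0≤+ (0≤+ 0≤e+g+h+2b 0≤t) 0≤e))))))
    (ℚ.<-irrefl refl)
  where
  0≤t : 0ℚ ≤ t
  0≤t = ℚ.<⇒≤ 0<t
  0≤e-t : 0ℚ ≤ e - t
  0≤e-t = ℚ.<⇒≤ (<⇒0<- t<e)
  0≤e : 0ℚ ≤ e
  0≤e = ℚ.<⇒≤ (ℚ.<-trans 0<t t<e)
  0≤h : 0ℚ ≤ (a - b) - (e + e)
  0≤h = ≤⇒0≤- (ℚ.≮⇒≥ ¬l)
  0≤e+g+h+2b : 0ℚ ≤ (e + ((a - b) - (e + e))) + (b + b)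
  0≤e+g+h+2b = 0≤+ (0≤+ 0≤e 0≤h) (0≤+ 0≤b 0≤b)
  lemma : ∀ p q t a b e →
    (((b + t) * (b + t) + - q) + (p + - (a * a))) + ((e * e + - (p + - q)) +
      (e * (((e + ((a + - b) + - (e + e))) + (b + b)) + t)
       + ((e + - t) + ((a + - b) + - (e + e))) * ((((e + ((a + - b) + - (e + e))) + (b + b)) + t) + e)))
    ≡ 0ℚ
  lemma p q t a b e = solve (p ∷ q ∷ t ∷ a ∷ b ∷ e ∷ []) acr

root-seq : ℝ → ℕ → ℚ
root-seq x n = proj₁ (approx-root (seq x n) n)

module _ (x : ℝ) (0<x : Posℝ x) where

  private
    r : ℕ → ℚ
    r = root-seq x

    r-root : Eventually λ n → IsRoot (seq x n) (τ n) (r n)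
    r-root = let _ , 0<ε , h = pos-elim {x} 0<x in
      ev-map (λ n ε<x → proj₂ (approx-root (seq x n) n) (ℚ.<⇒≤ (ℚ.<-trans 0<ε ε<x))) h

    neg-diff : ∀ a b → b + - a ≡ - (a + - b)
    neg-diff a b = solve (a ∷ b ∷ []) acr

    r-cauchy : IsCauchy r
    r-cauchy ε 0<ε =
      let e             = ½ * ε
          0<e           = 0<½* 0<ε
          n₁ , h        = ev-zip (λ _ → _,_) r-root (τ-small e 0<e)
          -- The square root is Hölder continuous of exponent one half: roots within 2 e require
          -- radicands within e².
          n₂ , k        = cauchy x (e * e) (0<* 0<e 0<e)
          half : ∀ m n → n₁ ℕ.⊔ n₂ ℕ.≤ m → n₁ ℕ.⊔ n₂ ℕ.≤ n → r m - r n < ε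
          half m n hm hn = subst (r m - r n <_) (½+½ ε)
            (root-diff e (0<τ n)
              (proj₁ (h m (ℕ.m⊔n≤o⇒m≤o n₁ n₂ hm))) (proj₁ (h n (ℕ.m⊔n≤o⇒m≤o n₁ n₂ hn)))
              (ℚ.≤-<-trans (p≤∣p∣ (seq x m - seq x n))
                 (k m n (ℕ.m⊔n≤o⇒n≤o n₁ n₂ hm) (ℕ.m⊔n≤o⇒n≤o n₁ n₂ hn)))
              (proj₂ (h n (ℕ.m⊔n≤o⇒m≤o n₁ n₂ hn))))
      in n₁ ℕ.⊔ n₂ , λ m n hm hn →
           ∣p∣<-intro (half m n hm hn) (subst (_< ε) (neg-diff (r m) (r n)) (half n m hn hm))

    s : ℝ
    s = r ,ᶜ r-cauchy

    s²≈x : s *ℝ s ≈ℝ x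
    s²≈x ε 0<ε =
      let B , 0<B , r≤B    = above s
          -- From r² ≤ x < (r + τ)² the error is below (2 r + τ) τ, hence below (2 B + 1) τ once τ <
          -- 1.
          0<B+B+1          = 0<+ (0<+ 0<B 0<B) (ℚ.positive⁻¹ 1ℚ)
          δ , 0<δ , Cδ≡ε   = divide 0<B+B+1 0<ε
      in ev-zip (λ n → λ where
           (root , r≤B) (τ<1 , τ<δ) → ∣p∣<-intro
             (ℚ.≤-<-trans (subst (r n * r n - seq x n ≤_) (ℚ.+-inverseʳ (seq x n)) (ℚ.+-monoˡ-≤ (- seq x n) (proj₁ (proj₂ root)))) 0<ε)
             (subst (- (r n * r n - seq x n) <_) Cδ≡ε
               (0<-⇒< (0<-respʳ (lemma₂ (r n) (seq x n) (τ n) B δ)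
                 (0<+≤ (<⇒0<- (proj₂ (proj₂ root)))
                   (0≤+ (0≤* (0≤+ (0≤+ (≤⇒0≤- r≤B) (≤⇒0≤- r≤B)) (ℚ.<⇒≤ (<⇒0<- τ<1))) (ℚ.<⇒≤ (0<τ n)))
                        (0≤* (ℚ.<⇒≤ 0<B+B+1) (ℚ.<⇒≤ (<⇒0<- τ<δ)))))))))
         (ev-zip (λ _ → _,_) r-root r≤B)
         (ev-zip (λ _ → _,_) (τ-small 1ℚ (ℚ.positive⁻¹ 1ℚ)) (τ-small δ 0<δ))
      where
      lemma₂ : ∀ r q t B δ →
        ((r + t) * (r + t) + - q) + (((B + - r) + (B + - r) + (1ℚ + - t)) * t + (B + B + 1ℚ) * (δ + - t))
        ≡ (B + B + 1ℚ) * δ + - (- (r * r + - q))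
      lemma₂ r q t B δ = solve (r ∷ q ∷ t ∷ B ∷ δ ∷ []) acr

  square-root : ∃[ s ] s *ℝ s ≈ℝ x
  square-root = s , s²≈x

-- The reals as an ordered ring

ℝ-commutativeRing : CommutativeRing 0ℓ 0ℓ
ℝ-commutativeRing = record
  { Carrier = ℝ ; _≈_ = _≈ℝ_ ; _+_ = _+ℝ_ ; _*_ = _*ℝ_ ; -_ = -ℝ_ ; 0# = 0ℝ ; 1# = 1ℝ
  ; isCommutativeRing = record
    { isRing = record
      { +-isAbelianGroup = record
        { isGroup = record
          { isMonoid = record
            { isSemigroup = record
              { isMagma = record
                { isEquivalence = ≈-isEquivalence
                ; ∙-cong = λ {x} {x′} {y} {y′} → +ℝ-cong x x′ y y′ }
              ; assoc = λ x y z → ≗⇒≈ℝ (x +ℝ y +ℝ z) (x +ℝ (y +ℝ z)) λ n → ℚ.+-assoc (seq x n) (seq y n) (seq z n) }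
            ; identity = (λ x → ≗⇒≈ℝ (0ℝ +ℝ x) x λ n → ℚ.+-identityˡ (seq x n))
                       , (λ x → ≗⇒≈ℝ (x +ℝ 0ℝ) x λ n → ℚ.+-identityʳ (seq x n)) }
          ; inverse = (λ x → ≗⇒≈ℝ (-ℝ x +ℝ x) 0ℝ λ n → ℚ.+-inverseˡ (seq x n))
                    , (λ x → ≗⇒≈ℝ (x +ℝ -ℝ x) 0ℝ λ n → ℚ.+-inverseʳ (seq x n))
          ; ⁻¹-cong = λ {x} {x′} → -ℝ-cong x x′ }
        ; comm = λ x y → ≗⇒≈ℝ (x +ℝ y) (y +ℝ x) λ n → ℚ.+-comm (seq x n) (seq y n) }
      ; *-cong = λ {x} {x′} {y} {y′} → *ℝ-cong x x′ y y′
      ; *-assoc = λ x y z → ≗⇒≈ℝ (x *ℝ y *ℝ z) (x *ℝ (y *ℝ z)) λ n → ℚ.*-assoc (seq x n) (seq y n) (seq z n)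
      ; *-identity = (λ x → ≗⇒≈ℝ (1ℝ *ℝ x) x λ n → ℚ.*-identityˡ (seq x n))
                   , (λ x → ≗⇒≈ℝ (x *ℝ 1ℝ) x λ n → ℚ.*-identityʳ (seq x n))
      ; distrib = (λ x y z → ≗⇒≈ℝ (x *ℝ (y +ℝ z)) (x *ℝ y +ℝ x *ℝ z) λ n → ℚ.*-distribˡ-+ (seq x n) (seq y n) (seq z n))
                , (λ x y z → ≗⇒≈ℝ ((y +ℝ z) *ℝ x) (y *ℝ x +ℝ z *ℝ x) λ n → ℚ.*-distribʳ-+ (seq x n) (seq y n) (seq z n)) }
    ; *-comm = λ x y → ≗⇒≈ℝ (x *ℝ y) (y *ℝ x) λ n → ℚ.*-comm (seq x n) (seq y n) } }
  where
  ≈-isEquivalence : IsEquivalence _≈ℝ_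
  ≈-isEquivalence = record
    { refl  = λ {x} → ≗⇒≈ℝ x x λ _ → refl
    ; sym   = λ {x} {y} → ≈ℝ-sym x y
    ; trans = λ {x} {y} {z} → ≈ℝ-trans x y z }

fromℚ-isRingHomomorphism : IsRingHomomorphism ℚ.+-*-rawRing ℝ-rawRing fromℚ
fromℚ-isRingHomomorphism = record
  { isSemiringHomomorphism = record
    { isNearSemiringHomomorphism = record
      { +-isMonoidHomomorphism = record
        { isMagmaHomomorphism = record
          { isRelHomomorphism = record { cong = λ {p} {q} p≡q → ≗⇒≈ℝ (fromℚ p) (fromℚ q) λ _ → p≡q }
          ; homo = λ p q → ≗⇒≈ℝ (fromℚ (p + q)) (fromℚ p +ℝ fromℚ q) λ _ → refl }
        ; ε-homo = ≗⇒≈ℝ 0ℝ 0ℝ λ _ → refl }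
      ; *-homo = λ p q → ≗⇒≈ℝ (fromℚ (p * q)) (fromℚ p *ℝ fromℚ q) λ _ → refl }
    ; 1#-homo = ≗⇒≈ℝ 1ℝ 1ℝ λ _ → refl }
  ; -‿homo = λ p → ≗⇒≈ℝ (fromℚ (- p)) (-ℝ fromℚ p) λ _ → refl }

ℝ-orderedAlgebra : OrderedAlgebra
ℝ-orderedAlgebra = record
  { commutativeRing = ℝ-commutativeRing
  ; ι = fromℚ
  ; ι-isRingHomomorphism = fromℚ-isRingHomomorphism
  ; Pos = Posℝ
  ; pos-resp = λ {x} {y} → pos-resp-≈ x y
  ; pos-+ = λ {x} {y} → pos-+ x y
  ; pos-* = λ {x} {y} → pos-* x y
  ; pos-+² = λ {x} → pos-+² x
  ; ¬pos-0 = ¬pos-0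
  ; pos-ι = λ {q} → pos-fromℚ q
  ; pos-cancel² = λ {x} → pos-cancel² x
  ; sign = λ {x} → sign x
  ; growth = λ {q} {b} a → growth q b a
  ; small-multiple = λ {y} x → small-multiple x y
  ; square-root = λ {x} → square-root x
  }

module 𝓡 = OrderedProperties ℝ-orderedAlgebra

-- The difference of the two sides of `ChordalWithin`, which turns closeness into positivity.
gap : ℚ → ℂ × ℂ → ℂ × ℂ → ℝ
gap ε u@(z , w) u′@(z′ , w′) =
  fromℚ ε *ℝ (‖ u ‖² *ℝ ‖ u′ ‖²) +ℝ -ℝ ∣ z *ℂ w′ -ℂ z′ *ℂ w ∣²

mixed-gap : ℝ → (x y z₁ z₂ w₁ w₂ : ℝ) → ℝ
mixed-gap e x y z₁ z₂ w₁ w₂ =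
  e *ℝ (norm² x y *ℝ (norm² z₁ z₂ +ℝ norm² w₁ w₂))
    +ℝ -ℝ (det x y z₁ w₁ *ℝ det x y z₁ w₁ +ℝ det x y z₂ w₂ *ℝ det x y z₂ w₂)
  where open 𝓡 using (norm²; det)

-- The imaginary parts of a convergent are constantly 0, so the identity already holds term by term
-- between rational numbers.
gap≈mixed-gap : ∀ ε x y z₁ z₂ w₁ w₂ →
  gap ε (fromℝ x , fromℝ y) ((z₁ +i z₂) , (w₁ +i w₂)) ≈ℝ mixed-gap (fromℚ ε) x y z₁ z₂ w₁ w₂
gap≈mixed-gap ε x y z₁ z₂ w₁ w₂ =
  ≗⇒≈ℝ (gap ε (fromℝ x , fromℝ y) ((z₁ +i z₂) , (w₁ +i w₂)))
       (mixed-gap (fromℚ ε) x y z₁ z₂ w₁ w₂)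
    λ n → expand ε (seq x n) (seq y n) (seq z₁ n) (seq z₂ n) (seq w₁ n) (seq w₂ n)
  where
  open import Data.Rational.Solver using (module +-*-Solver)
  open +-*-Solver renaming (solve to solveℚ)
  expand : ∀ e x y z₁ z₂ w₁ w₂ →
    e * (((x * x + 0ℚ * 0ℚ) + (y * y + 0ℚ * 0ℚ)) * ((z₁ * z₁ + z₂ * z₂) + (w₁ * w₁ + w₂ * w₂)))
    + - (((x * w₁ + - (0ℚ * w₂)) + - (z₁ * y + - (z₂ * 0ℚ))) * ((x * w₁ + - (0ℚ * w₂)) + - (z₁ * y + - (z₂ * 0ℚ)))
       + ((x * w₂ + 0ℚ * w₁) + - (z₁ * 0ℚ + z₂ * y)) * ((x * w₂ + 0ℚ * w₁) + - (z₁ * 0ℚ + z₂ * y)))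
    ≡ e * ((x * x + y * y) * ((z₁ * z₁ + z₂ * z₂) + (w₁ * w₁ + w₂ * w₂)))
    + - ((x * w₁ + - (z₁ * y)) * (x * w₁ + - (z₁ * y)) + (x * w₂ + - (z₂ * y)) * (x * w₂ + - (z₂ * y)))
  expand = solveℚ 7 (λ e x y z₁ z₂ w₁ w₂ →
    let o = con 0ℚ ; p = (z₁ :* z₁ :+ z₂ :* z₂) :+ (w₁ :* w₁ :+ w₂ :* w₂)
        a = (x :* w₁ :+ :- (o :* w₂)) :+ :- (z₁ :* y :+ :- (z₂ :* o))
        b = (x :* w₂ :+ o :* w₁) :+ :- (z₁ :* o :+ z₂ :* y)
        a′ = x :* w₁ :+ :- (z₁ :* y) ; b′ = x :* w₂ :+ :- (z₂ :* y) in
    e :* (((x :* x :+ o :* o) :+ (y :* y :+ o :* o)) :* p) :+ :- (a :* a :+ b :* b)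
    := e :* ((x :* x :+ y :* y) :* p) :+ :- (a′ :* a′ :+ b′ :* b′)) ≡.refl

real-gap : ℝ → (x y z w : ℝ) → ℝ
real-gap e x y z w = e *ℝ (norm² x y *ℝ norm² z w) +ℝ -ℝ (det x y z w *ℝ det x y z w)
  where open 𝓡 using (norm²; det)

real-gap≈gap : ∀ ε x y z w →
  real-gap (fromℚ ε) x y z w ≈ℝ gap ε (fromℝ x , fromℝ y) (fromℝ z , fromℝ w)
real-gap≈gap ε x y z w =
  ≗⇒≈ℝ (real-gap (fromℚ ε) x y z w) (gap ε (fromℝ x , fromℝ y) (fromℝ z , fromℝ w))
    λ n → expand ε (seq x n) (seq y n) (seq z n) (seq w n)
  where
  open import Data.Rational.Solver using (module +-*-Solver)
  open +-*-Solver renaming (solve to solveℚ)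
  expand : ∀ e x y z w →
    e * ((x * x + y * y) * (z * z + w * w)) + - ((x * w + - (z * y)) * (x * w + - (z * y))) ≡
    e * (((x * x + 0ℚ * 0ℚ) + (y * y + 0ℚ * 0ℚ)) * ((z * z + 0ℚ * 0ℚ) + (w * w + 0ℚ * 0ℚ)))
    + - (((x * w + - (0ℚ * 0ℚ)) + - (z * y + - (0ℚ * 0ℚ))) * ((x * w + - (0ℚ * 0ℚ)) + - (z * y + - (0ℚ * 0ℚ)))
       + ((x * 0ℚ + 0ℚ * w) + - (z * 0ℚ + 0ℚ * y)) * ((x * 0ℚ + 0ℚ * w) + - (z * 0ℚ + 0ℚ * y)))
  expand = solveℚ 5 (λ e x y z w →
    let o = con 0ℚ ; oo = o :* o
        d = x :* w :+ :- (z :* y)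
        a = (x :* w :+ :- oo) :+ :- (z :* y :+ :- oo)
        b = (x :* o :+ o :* w) :+ :- (z :* o :+ o :* y) in
    e :* ((x :* x :+ y :* y) :* (z :* z :+ w :* w)) :+ :- (d :* d)
    := e :* (((x :* x :+ oo) :+ (y :* y :+ oo)) :* ((z :* z :+ oo) :+ (w :* w :+ oo)))
       :+ :- (a :* a :+ b :* b)) ≡.refl

-- Convergence and divergence in the projective line

module _ {c ℓ} {K : RealQuadraticField c ℓ} (P : PeriodicCF K) where

  open RealQuadraticField K using (σ; σ-isRingHomomorphism; Positive; Negative; IsSquare)
  open PCF P
  private
    module 𝓔 = Embedded P ℝ-orderedAlgebra σ σ-isRingHomomorphism

  positive⇒converges : Positive Δ → ¬ IsSquare Δ → Converges
  positive⇒converges 0<Δ ¬sq =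
    let px , py , 0<p , close = 𝓔.converges 0<Δ ¬sq
    in record { coords = fromℝ px , fromℝ py ; nonzero = norm-pos px py 0<p } , λ ε 0<ε →
      ev-map (λ n h →
          pos⇒<ℝ ∣ fromℝ (𝓔.x n) *ℂ fromℝ py -ℂ fromℝ px *ℂ fromℝ (𝓔.y n) ∣²
            (fromℚ ε *ℝ (‖ convergent n ‖² *ℝ ‖ fromℝ px , fromℝ py ‖²))
            (pos-resp-≈ (real-gap (fromℚ ε) (𝓔.x n) (𝓔.y n) px py)
              (gap ε (convergent n) (fromℝ px , fromℝ py)) (real-gap≈gap ε (𝓔.x n) (𝓔.y n) px py) h))
        (close {fromℚ ε} (pos-fromℚ ε 0<ε))
    where
    norm-pos : ∀ px py → Posℝ (𝓡.norm² px py) → Posℝ ‖ fromℝ px , fromℝ py ‖²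
    norm-pos px py = pos-resp-≈ (𝓡.norm² px py) ‖ fromℝ px , fromℝ py ‖²
      (≗⇒≈ℝ (𝓡.norm² px py) ‖ fromℝ px , fromℝ py ‖² λ n →
      ≡.sym (≡.cong₂ ℚ._+_ (ℚ.+-identityʳ (seq px n ℚ.* seq px n)) (ℚ.+-identityʳ (seq py n ℚ.* seq py n))))

  negative⇒diverges : Negative Δ → ¬ Converges
  negative⇒diverges Δ<0 (p , tends) =
    let ε , 0<ε , separate = 𝓔.diverges (pos-resp-≈ (0ℝ +ℝ -ℝ σ Δ) (-ℝ σ Δ)
          (≗⇒≈ℝ (0ℝ +ℝ -ℝ σ Δ) (-ℝ σ Δ) λ n → ℚ.+-identityˡ (ℚ.- seq (σ Δ) n)) (<ℝ⇒pos (σ Δ) 0ℝ Δ<0))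
        n₀ , within = tends ε 0<ε
        n = n₀ ℕ.⊔ N
        n₀≤n = ℕ.m≤m⊔n n₀ N
    in separate (re z) (im z) (re w) (im w) n (ℕ.m≤n⊔m n₀ N) (ℙ¹.nonzero p) (close ε n (within n n₀≤n))
         (close ε (n ℕ.+ k) (within (n ℕ.+ k) (ℕ.≤-trans n₀≤n (ℕ.m≤m+n n k))))
    where
    open PeriodicCF P using (N; k)
    z w : ℂ
    z = proj₁ (ℙ¹.coords p)
    w = proj₂ (ℙ¹.coords p)
    close : ∀ ε n → ChordalWithin ε (convergent n) (ℙ¹.coords p) →
      𝓡.Close (fromℚ ε) (𝓔.x n) (𝓔.y n) (re z) (im z) (re w) (im w)
    close ε n h = pos-resp-≈ (gap ε (convergent n) (ℙ¹.coords p))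
      (mixed-gap (fromℚ ε) (𝓔.x n) (𝓔.y n) (re z) (im z) (re w) (im w))
      (gap≈mixed-gap ε (𝓔.x n) (𝓔.y n) (re z) (im z) (re w) (im w))
      (<ℝ⇒pos ∣ fromℝ (𝓔.x n) *ℂ w -ℂ z *ℂ fromℝ (𝓔.y n) ∣²
         (fromℚ ε *ℝ (‖ convergent n ‖² *ℝ ‖ ℙ¹.coords p ‖²)) h)

lemma1 : ∀ {c ℓ : Level} (K : RealQuadraticField c ℓ) (P : PeriodicCF K) →
    (∀ i → RealQuadraticField.IsAlgebraicInteger K (PeriodicCF.a P i)) →
    (RealQuadraticField.Positive K (PCF.Δ P) →
    ¬ RealQuadraticField.IsSquare K (PCF.Δ P) → PCF.Converges P)
    × (RealQuadraticField.Negative K (PCF.Δ P) → ¬ PCF.Converges P)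
lemma1 K P _ = positive⇒converges P , negative⇒diverges P
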